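{- Let $k \ge 1$ and $c \ge 1$ be integers, let $\phi\colon \mathbb{F}_2^k \to \mathbb{F}_{2^k}$ be an $\mathbb{F}_2$-linear isomorphism, and let $f\colon \{0,1\}^k \times \{0,1\}^k \times \{0,1\}^k \to \{0,1\}$ be the function defined by \[ f(x,y,z) = \operatorname{Tr}(\phi(x)\cdot\phi(y)\cdot\phi(z)). \] Then $f$, viewed as a Boolean function on $\{0,1\}^{3k}$, is a directional affine extractor for dimension $2k+c$ with bias $\epsilon \le 2^{ -c}$. In particular, $f$ is a directional affine disperser for dimension $2k+1$.
   Context: Identify $\{0,1\}^n$ with $\mathbb{F}_2^n$; addition is over $\mathbb{F}_2$. The trace map $\operatorname{Tr}\colon \mathbb{F}_{2^k} \to \mathbb{F}_2$ is $\operatorname{Tr}(x) = \sum_{i=0}^{k-1} x^{2^i}$. For a Boolean function $h\colon\{0,1\}^n\to\{0,1\}$ and a nonempty $S\subseteq\{0,1\}^n$, the bias of $h$ restricted to $S$ is $\operatorname{bias}(h|_S) = \left|\mathbb{E}_{x}[(-1)^{h(x)}]\right|$, where $x$ is uniform on $S$. The function $h$ is an affine extractor for dimension $d$ with bias $\epsilon$ if for every affine subspace $S\subseteq\mathbb{F}_2^n$ of dimension $d$, $\operatorname{bias}(h|_S)\le\epsilon$. It is an affine disperser for dimension $d$ if $h$ is not constant on any affine subspace of dimension at least $d$. For non-zero $a\in\{0,1\}^n$, the directional derivative is $D_a h(x) = h(x+a)+h(x)$. The function $h$ is a directional affine extractor for dimension $d$ with bias $\epsilon$ if for every non-zero $a$,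 $D_a h$ is an affine extractor for dimension $d$ with bias $\epsilon$. It is a directional affine disperser for dimension $d$ if for every non-zero $a$, $D_a h$ is an affine disperser for dimension $d$. -}

module Defs where

open import Algebra.Apartness.Bundles using (HeytingField)
open import Algebra.Bundles using (CommutativeRing; Semiring)
open import Algebra.Module.Bundles.Raw using (RawLeftModule)
open import Algebra.Module.Morphism.Structures using (module LeftModuleMorphisms)
import Algebra.Definitions.RawSemiring as RawSemiringDefinitions
open import Data.Bool.Base using (Bool; true; false; if_then_else_; _∧_; _xor_)
open import Data.Fin.Base using (Fin; toℕ)
import Data.Fin.Properties as Fin
open import Data.Integer.Base as ℤ using (ℤ; 0ℤ; 1ℤ; -1ℤ)
open import Data.List.Base as List using (List; []; _∷_)
open import Data.List.Membership.Propositional using (_∈_)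
open import Data.List.Membership.Propositional.Properties
  using (∈-cartesianProductWith⁺; ∈-filter⁺)
open import Data.List.Relation.Unary.Any using (here; there)
open import Data.Nat.Base using (ℕ; zero; suc; NonZero; _≤_; _^_; _*_)
open import Data.Nat.Properties using (m^n≢0)
open import Data.Product.Base using (∃; _,_)
open import Data.Rational.Base as ℚ using (ℚ)
open import Data.Vec.Base as Vec using (Vec; []; _∷_)
open import Function.Bundles using (Inverse; _⇔_; module Equivalence)
open import Function.Properties.Inverse using (Inverse⇒Injection)
import Function.Construct.Symmetry as Symmetry
open import Level using (Level; 0ℓ; _⊔_) renaming (suc to lsuc)
open import Relation.Binary.Definitions using () renaming (Decidable to Decidable₂)
open import Relation.Binary.PropositionalEquality as ≡ using (_≡_; _≢_; refl)
open import Relation.Nullary.Decidable using (does)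
open import Relation.Nullary.Negation using (¬_)
open import Relation.Unary using (Pred; Decidable; Satisfiable)
import Relation.Nullary.Decidable as Dec

-- The space 𝔽₂ⁿ = {0,1}ⁿ: Bool is 𝔽₂, with _xor_ and _∧_ as field operations.

𝔽₂^ : ℕ → Set
𝔽₂^ n = Vec Bool n

infixl 6 _⊕_
infixr 7 _•_

_⊕_ : ∀ {n} → 𝔽₂^ n → 𝔽₂^ n → 𝔽₂^ n
_⊕_ = Vec.zipWith _xor_

𝟎 : ∀ {n} → 𝔽₂^ n
𝟎 {n} = Vec.replicate n false

_•_ : ∀ {n} → Bool → 𝔽₂^ n → 𝔽₂^ n
b • v = Vec.map (b ∧_) v

𝔽₂^-rawModule : ℕ → RawLeftModule Bool 0ℓ 0ℓ
𝔽₂^-rawModule n = record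
  { Carrierᴹ = 𝔽₂^ n
  ; _≈ᴹ_     = _≡_
  ; _+ᴹ_     = _⊕_
  ; _*ₗ_     = _•_
  ; 0ᴹ       = 𝟎
  ; -ᴹ_      = λ v → v
  }

linearCombination : ∀ {n d} → Vec Bool d → Vec (𝔽₂^ n) d → 𝔽₂^ n
linearCombination cs vs = Vec.foldr′ _⊕_ 𝟎 (Vec.zipWith _•_ cs vs)

LinearlyIndependent : ∀ {n d} → Vec (𝔽₂^ n) d → Set
LinearlyIndependent vs = ∀ cs → linearCombination cs vs ≡ 𝟎 → cs ≡ 𝟎

-- S is a translate of a linear subspace that has a basis of size d.
record IsAffineSubspace {n : ℕ} (d : ℕ) (S : Pred (𝔽₂^ n) 0ℓ) : Set where
  field
    origin      : 𝔽₂^ n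
    basis       : Vec (𝔽₂^ n) d
    independent : LinearlyIndependent basis
    membership  : ∀ x → S x ⇔ ∃ λ cs → x ≡ origin ⊕ linearCombination cs basis

  nonempty : Satisfiable S
  nonempty = _ , Equivalence.from (membership _) (𝟎 , refl)

-- Every vector occurs exactly once in this list.
allVectors : ∀ n → List (𝔽₂^ n)
allVectors zero    = [] ∷ []
allVectors (suc n) = List.cartesianProductWith _∷_ (false ∷ true ∷ []) (allVectors n)

allVectors-complete : ∀ {n} (x : 𝔽₂^ n) → x ∈ allVectors n
allVectors-complete []          = here refl
allVectors-complete (b ∷ x) =
  ∈-cartesianProductWith⁺ _∷_ (bools-complete b) (allVectors-complete x)
  where
  bools-complete : ∀ b → b ∈ false ∷ true ∷ []
  bools-complete false = here refl
  bools-complete true  = there (here refl)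

module _ {n : ℕ} {S : Pred (𝔽₂^ n) 0ℓ} (S? : Decidable S) where

  elements : List (𝔽₂^ n)
  elements = List.filter S? (allVectors n)

  size : ℕ
  size = List.length elements

  size-nonZero : Satisfiable S → NonZero size
  size-nonZero (x , x∈S) = length-nonZero (∈-filter⁺ S? (allVectors-complete x) x∈S)
    where
    length-nonZero : ∀ {xs : List (𝔽₂^ n)} → x ∈ xs → NonZero (List.length xs)
    length-nonZero (here _)  = _
    length-nonZero (there _) = _

  expectation : Satisfiable S → (𝔽₂^ n → ℤ) → ℚ
  expectation ne g = (List.foldr ℤ._+_ 0ℤ (List.map g elements) ℚ./ size) {{size-nonZero ne}}

  bias : (𝔽₂^ n → Bool) → Satisfiable S → ℚ
  bias h ne = ℚ.∣ expectation ne (λ x → if h x then -1ℤ else 1ℤ) ∣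

IsAffineExtractor : ∀ {n} → (𝔽₂^ n → Bool) → ℕ → ℚ → Set₁
IsAffineExtractor {n} h d ε =
  ∀ {S : Pred (𝔽₂^ n) 0ℓ} (S? : Decidable S) (aff : IsAffineSubspace d S) →
  bias S? h (IsAffineSubspace.nonempty aff) ℚ.≤ ε

ConstantOn : ∀ {n} → (𝔽₂^ n → Bool) → Pred (𝔽₂^ n) 0ℓ → Set
ConstantOn h S = ∃ λ b → ∀ x → S x → h x ≡ b

IsAffineDisperser : ∀ {n} → (𝔽₂^ n → Bool) → ℕ → Set₁
IsAffineDisperser {n} h d =
  ∀ {e} → d ≤ e → {S : Pred (𝔽₂^ n) 0ℓ} → IsAffineSubspace e S → ¬ ConstantOn h S

derivative : ∀ {n} → 𝔽₂^ n → (𝔽₂^ n → Bool) → 𝔽₂^ n → Bool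
derivative a h x = h (x ⊕ a) xor h x

IsDirectionalAffineExtractor : ∀ {n} → (𝔽₂^ n → Bool) → ℕ → ℚ → Set₁
IsDirectionalAffineExtractor h d ε = ∀ a → a ≢ 𝟎 → IsAffineExtractor (derivative a h) d ε

IsDirectionalAffineDisperser : ∀ {n} → (𝔽₂^ n → Bool) → ℕ → Set₁
IsDirectionalAffineDisperser h d = ∀ a → a ≢ 𝟎 → IsAffineDisperser (derivative a h) d

2^-_ : ℕ → ℚ
2^- c = (ℤ.+ 1 ℚ./ (2 ^ c)) {{m^n≢0 2 c}}

-- A field with exactly q elements. Equality is then decidable, and so is
-- invertibility (by search), so that the apartness _#_ is just the negation of _≈_.
record FiniteField (q : ℕ) (c ℓ₁ ℓ₂ : Level) : Set (lsuc (c ⊔ ℓ₁ ⊔ ℓ₂)) where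
  field
    heytingField : HeytingField c ℓ₁ ℓ₂

  open HeytingField heytingField public hiding (_-_)

  commutativeRing : CommutativeRing c ℓ₁
  commutativeRing = record { isCommutativeRing = isCommutativeRing }

  open Semiring (CommutativeRing.semiring commutativeRing) public using (rawSemiring)

  field
    enumeration : Inverse (≡.setoid (Fin q)) (CommutativeRing.setoid commutativeRing)

  infix 4 _≟_

  _≟_ : Decidable₂ _≈_
  _≟_ = Dec.via-injection (Inverse⇒Injection (Symmetry.inverse enumeration)) Fin._≟_

-- A field with 2ᵏ elements has characteristic 2, so Bool embeds in it as the
-- prime subfield {0#, 1#}.
module _ {k : ℕ} {c ℓ₁ ℓ₂ : Level} (𝔽 : FiniteField (2 ^ k) c ℓ₁ ℓ₂) where
  open FiniteField 𝔽 using (Carrier; _≈_; 0#; 1#; -_; _≟_; rawSemiring)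
    renaming (_+_ to _+ᶠ_; _*_ to _*ᶠ_)
  open RawSemiringDefinitions rawSemiring using (sum) renaming (_^_ to _^ᶠ_)

  fromBool : Bool → Carrier
  fromBool b = if b then 1# else 0#

  𝔽-rawModule : RawLeftModule Bool c ℓ₁
  𝔽-rawModule = record
    { Carrierᴹ = Carrier
    ; _≈ᴹ_     = _≈_
    ; _+ᴹ_     = _+ᶠ_
    ; _*ₗ_     = λ b x → fromBool b *ᶠ x
    ; 0ᴹ       = 0#
    ; -ᴹ_      = -_
    }

  open LeftModuleMorphisms (𝔽₂^-rawModule k) 𝔽-rawModule public
    using () renaming (IsLeftModuleIsomorphism to IsLinearIsomorphism)

  trace : Carrier → Carrier
  trace x = sum {k} (λ i → x ^ᶠ (2 ^ toℕ i))

  -- trace x is always 0# or 1#; Tr x is the corresponding element of Bool.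
  Tr : Carrier → Bool
  Tr x = does (trace x ≟ 1#)

  traceProduct : (𝔽₂^ k → Carrier) → 𝔽₂^ k → 𝔽₂^ k → 𝔽₂^ k → Bool
  traceProduct φ x y z = Tr (φ x *ᶠ φ y *ᶠ φ z)

-- {0,1}ᵏ × {0,1}ᵏ × {0,1}ᵏ is identified with {0,1}³ᵏ by concatenation.
onTriples : ∀ {k} → (𝔽₂^ k → 𝔽₂^ k → 𝔽₂^ k → Bool) → 𝔽₂^ (3 * k) → Bool
onTriples {k} f v =
  f (Vec.take k v) (Vec.take k (Vec.drop k v)) (Vec.take k (Vec.drop k (Vec.drop k v)))

{-# OPTIONS --safe #-}

-- Let S be an affine subspace of dimension d and suppose a₁ ≠ 0; the other cases follow by symmetry.
-- For fixed x and y, the derivative D_a f(x, y, z) is affine in z, with a linear part of the form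
-- z ↦ Tr (a₁ y z) + μₓ(z) where μₓ does not depend on y, and the fibre of S over (x, y) is empty or
-- a translate of W = {w : (0, 0, w) is a direction of S}. Hence the sum of (-1)^(D_a f) over the
-- fibre is, in absolute value, at most P(x, y) = Σ_{w ∈ W} (-1)^(Tr (a₁ y w) + μₓ(w)), which is
-- either 0 or |W|. Since the trace form is nondegenerate, Σ_y P(x, y) = 2ᵏ: only w = 0 survives.
-- So the sum over S is at most 2²ᵏ in absolute value, whereas |S| = 2ᵈ.

module Submission where

open import Defs
open import Level using (Level; _⊔_; 0ℓ)
open import Data.Nat.Base using (ℕ; zero; suc; NonZero; _+_; _*_; _∸_; _^_; _≤_; z≤n; s≤s)
open import Data.Product.Base using (_×_; _,_; proj₁; proj₂; ∃; ∃₂)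
open import Algebra.Bundles using (CommutativeMonoid; CommutativeRing; CommutativeSemigroup)
open import Algebra.Module.Morphism.Structures using (module LeftModuleMorphisms)
import Algebra.Properties.CommutativeMonoid.Sum as MonoidSum
import Algebra.Properties.CommutativeSemigroup as CommutativeSemigroupProperties
import Algebra.Properties.CommutativeSemiring.Exp as Exp
import Algebra.Properties.Ring as RingProperties
import Algebra.Solver.Ring.NaturalCoefficients.Default as SemiringSolver
open import Data.Bool.Base using (Bool; true; false; if_then_else_; _∧_; _xor_)
import Data.Bool.Properties as Bool
open import Data.Bool.Solver using (module xor-∧-Solver)
open import Data.Fin.Base using (Fin; zero; suc; toℕ; inject≤)
open import Data.Fin.Permutation using (permutation)
import Data.Fin.Properties as Fin
open import Data.Integer.Base as ℤ using (ℤ; +_; 0ℤ; 1ℤ; -1ℤ; ∣_∣)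
import Data.Integer.Properties as ℤ
open import Data.List.Base as List using (List; []; _∷_)
import Data.List.Properties as List
import Data.Nat.Properties as ℕ
import Data.Rational.Base as ℚ
import Data.Rational.Properties as ℚ
import Data.Rational.Unnormalised.Base as ℚᵘ
import Data.Rational.Unnormalised.Properties as ℚᵘ
open import Data.Sum.Base using (_⊎_; inj₁; inj₂)
open import Data.Vec.Base as Vec using (Vec; []; _∷_; _++_)
open import Data.Vec.Functional using (Vector)
import Data.Vec.Properties as Vec
open import Function.Base using (_∘_)
open import Function.Bundles using (module Equivalence; module Inverse)
open import Relation.Binary.Definitions using () renaming (Decidable to Decidable₂)
open import Relation.Binary.PropositionalEquality as ≡ using (_≡_; _≢_; _≗_)
open import Relation.Binary.PropositionalEquality.Algebra using (isMagma)
import Relation.Binary.Reasoning.Setoid as SetoidReasoning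
open import Relation.Nullary.Decidable using (Dec; yes; no; does; map′; dec-true; dec-false)
open import Relation.Nullary.Negation using (¬_; contradiction)
open import Relation.Unary using (Pred; Decidable)

-- Taking absolute values fibre by fibre would normally destroy the cancellation in `y`. It survives
-- because the fibre bound is itself a character sum over the group W: being non-negative, it can
-- stand for every fibre, empty ones included, and be summed over all `y` with its signs intact. On
-- the side of the field, the argument rests on two facts about `Tr`, which is defined by comparing
-- the trace with 1: it is additive, and it is not identically false. Additivity needs the trace to
-- take only the values 0 and 1, which comes from x^(2^k) = x. The trace does not vanish identically
-- because it is a monic polynomial of degree 2^(k-1), less than the number of field elements.
-- Multiplicative inverses then turn a single element of trace 1 into nondegeneracy.

⊕-self : ∀ {n} (v : 𝔽₂^ n) → v ⊕ v ≡ 𝟎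
⊕-self []      = ≡.refl
⊕-self (b ∷ v) = ≡.cong₂ _∷_ (Bool.xor-same b) (⊕-self v)

module _ {a ℓ} (M : CommutativeMonoid a ℓ) where
  open CommutativeMonoid M
  open MonoidSum M

  sum-support : ∀ {n} (f : Vector Carrier n) i → (∀ j → j ≢ i → f j ≈ ε) → sum f ≈ f i
  sum-support {suc n} f zero f≈ε =
    trans (∙-congˡ (trans (sum-cong-≋ (λ j → f≈ε (suc j) λ ())) (sum-replicate-zero n)))
          (identityʳ _)
  sum-support {suc n} f (suc i) f≈ε =
    trans (∙-cong (f≈ε zero λ ())
                  (sum-support (f ∘ suc) i (λ j j≢i → f≈ε (suc j) (j≢i ∘ Fin.suc-injective))))
          (identityˡ _)

-- Polynomial functions and the number of their roots

module Polynomial {a ℓ} (R : CommutativeRing a ℓ) where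
  open CommutativeRing R hiding (zero) renaming (_+_ to _+ᶠ_; _*_ to _*ᶠ_)
  open Exp commutativeSemiring using () renaming (_^_ to _^ᶠ_)
  open SetoidReasoning setoid
  open SemiringSolver commutativeSemiring using (solve; _:+_; _:*_; _:=_)

  -- g is the function of a polynomial with coefficient l in degree d and no terms of
  -- higher degree; l may be 0#.
  Poly : Carrier → ℕ → (Carrier → Carrier) → Set (a ⊔ ℓ)
  Poly l zero    g = ∀ x → g x ≈ l
  Poly l (suc d) g = ∃₂ λ c q → Poly l d q × ∀ x → g x ≈ c +ᶠ x *ᶠ q x

  Poly-resp : ∀ {l m} d {g h} → l ≈ m → (∀ x → g x ≈ h x) → Poly l d g → Poly m d h
  Poly-resp zero    l≈m g≗h p             x = trans (sym (g≗h x)) (trans (p x) l≈m)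
  Poly-resp (suc d) l≈m g≗h (c , q , p , e) =
    c , q , Poly-resp d l≈m (λ _ → refl) p , λ x → trans (sym (g≗h x)) (e x)

  Poly-+ : ∀ {l m} d {g h} → Poly l d g → Poly m d h → Poly (l +ᶠ m) d (λ x → g x +ᶠ h x)
  Poly-+ zero    p p′ x = +-cong (p x) (p′ x)
  Poly-+ (suc d) {g} {h} (c , q , p , e) (c′ , q′ , p′ , e′) =
    c +ᶠ c′ , (λ x → q x +ᶠ q′ x) , Poly-+ d p p′ , λ x → begin
      g x +ᶠ h x
        ≈⟨ +-cong (e x) (e′ x) ⟩
      (c +ᶠ x *ᶠ q x) +ᶠ (c′ +ᶠ x *ᶠ q′ x)
        ≈⟨ solve 5 (λ c c′ x q q′ → (c :+ x :* q) :+ (c′ :+ x :* q′)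
                                  := (c :+ c′) :+ x :* (q :+ q′))
                 refl c c′ x (q x) (q′ x) ⟩
      (c +ᶠ c′) +ᶠ x *ᶠ (q x +ᶠ q′ x) ∎

  Poly-* : ∀ b {l} d {g} → Poly l d g → Poly (b *ᶠ l) d (λ x → b *ᶠ g x)
  Poly-* b zero    p x = *-congˡ (p x)
  Poly-* b (suc d) {g} (c , q , p , e) = b *ᶠ c , (λ x → b *ᶠ q x) , Poly-* b d p , λ x → begin
    b *ᶠ g x
      ≈⟨ *-congˡ (e x) ⟩
    b *ᶠ (c +ᶠ x *ᶠ q x)
      ≈⟨ solve 4 (λ b c x q → b :* (c :+ x :* q) := b :* c :+ x :* (b :* q)) refl b c x (q x) ⟩
    b *ᶠ c +ᶠ x *ᶠ (b *ᶠ q x) ∎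

  -- `Poly-+` adds only polynomials of equal formal degree; padding with a zero top coefficient
  -- brings the smaller one up.
  Poly-suc : ∀ {l} d {g} → Poly l d g → Poly 0# (suc d) g
  Poly-suc {l} zero p = l , (λ _ → 0#) , (λ _ → refl) , λ x →
    trans (p x) (sym (trans (+-congˡ (zeroʳ x)) (+-identityʳ l)))
  Poly-suc (suc d) (c , q , p , e) = c , q , Poly-suc d p , e

  Poly-0# : ∀ d → Poly 0# d (λ _ → 0#)
  Poly-0# zero    _ = refl
  Poly-0# (suc d) = Poly-suc d (Poly-0# d)

  Poly-+ˡ : ∀ j {d g} → Poly 0# d g → Poly 0# (j + d) g
  Poly-+ˡ zero    p = p
  Poly-+ˡ (suc j) p = Poly-suc _ (Poly-+ˡ j p)

  Poly-^ : ∀ d → Poly 1# d (_^ᶠ d)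
  Poly-^ zero    _ = refl
  Poly-^ (suc d) = 0# , (_^ᶠ d) , Poly-^ d , λ _ → sym (+-identityˡ _)

  -- The factorisation g x - g a = (x - a) * q x, with the terms moved so that no subtraction
  -- occurs: this makes it a semiring identity.
  Poly-slope : ∀ {l} d {g} → Poly l (suc d) g → ∀ a →
               ∃ λ q → Poly l d q × ∀ x → g x +ᶠ a *ᶠ q x ≈ g a +ᶠ x *ᶠ q x
  Poly-slope zero {g} (c , r , p , e) a = r , p , λ x → begin
    g x +ᶠ a *ᶠ r x
      ≈⟨ +-cong (e x) (*-congˡ (trans (p x) (sym (p a)))) ⟩
    (c +ᶠ x *ᶠ r x) +ᶠ a *ᶠ r a
      ≈⟨ solve 3 (λ c u v → (c :+ u) :+ v := (c :+ v) :+ u) refl c _ _ ⟩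
    (c +ᶠ a *ᶠ r a) +ᶠ x *ᶠ r x
      ≈⟨ +-congʳ (e a) ⟨
    g a +ᶠ x *ᶠ r x ∎
  Poly-slope {l} (suc d) {g} (c , r , p , e) a with Poly-slope d p a
  ... | s , p′ , e′ =
    (λ x → r x +ᶠ a *ᶠ s x) ,
    -- The correction `a *ᶠ s x` has lower degree than `r`, so the leading coefficient stays `l`.
    Poly-resp (suc d) (+-identityʳ l) (λ _ → refl) (Poly-+ (suc d) p (Poly-suc d (Poly-* a d p′))) ,
    λ x → begin
      g x +ᶠ a *ᶠ (r x +ᶠ a *ᶠ s x)
        ≈⟨ +-cong (e x) (*-congˡ (e′ x)) ⟩
      (c +ᶠ x *ᶠ r x) +ᶠ a *ᶠ (r a +ᶠ x *ᶠ s x)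
        ≈⟨ solve 6 (λ c x a rx ra sx → (c :+ x :* rx) :+ a :* (ra :+ x :* sx)
                                      := (c :+ a :* ra) :+ x :* (rx :+ a :* sx))
                 refl c x a (r x) (r a) (s x) ⟩
      (c +ᶠ a *ᶠ r a) +ᶠ x *ᶠ (r x +ᶠ a *ᶠ s x)
        ≈⟨ +-congʳ (e a) ⟨
      g a +ᶠ x *ᶠ (r x +ᶠ a *ᶠ s x) ∎

  module _ (*-cancelʳ : ∀ {x y z : Carrier} → ¬ z ≈ 0# → x *ᶠ z ≈ y *ᶠ z → x ≈ y) (1≉0 : ¬ 1# ≈ 0#)
           (_≟_ : Decidable₂ _≈_) where

    -- Divide out the root `r zero`: the quotient is again monic, and it vanishes at the other
    -- roots, since a non-zero value there could be cancelled to give `r zero ≈ r (suc i)`. In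
    -- degree 0 a monic polynomial is the constant `1#`.
    ¬too-many-roots : ∀ d {g} → Poly 1# d g → (r : Fin (suc d) → Carrier) →
                      (∀ i j → r i ≈ r j → i ≡ j) → ¬ (∀ i → g (r i) ≈ 0#)
    ¬too-many-roots zero    p r r-inj root = 1≉0 (trans (sym (p _)) (root zero))
    ¬too-many-roots (suc d) {g} p r r-inj root with Poly-slope d p (r zero)
    ... | q , q-monic , slope =
      ¬too-many-roots d q-monic (r ∘ suc) (λ i j → Fin.suc-injective ∘ r-inj (suc i) (suc j)) root′
      where
      root′ : ∀ i → q (r (suc i)) ≈ 0#
      root′ i with q (r (suc i)) ≟ 0#
      ... | yes q≈0 = q≈0
      ... | no  q≉0 = contradiction (r-inj zero (suc i) (*-cancelʳ q≉0 (begin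
        r zero *ᶠ q (r (suc i))                  ≈⟨ +-identityˡ _ ⟨
        0# +ᶠ r zero *ᶠ q (r (suc i))            ≈⟨ +-congʳ (root (suc i)) ⟨
        g (r (suc i)) +ᶠ r zero *ᶠ q (r (suc i)) ≈⟨ slope (r (suc i)) ⟩
        g (r zero) +ᶠ r (suc i) *ᶠ q (r (suc i)) ≈⟨ +-congʳ (root zero) ⟩
        0# +ᶠ r (suc i) *ᶠ q (r (suc i))         ≈⟨ +-identityˡ _ ⟩
        r (suc i) *ᶠ q (r (suc i))               ∎))) λ ()

-- Arithmetic in a finite field

module FiniteFieldProperties {q : ℕ} {c ℓ₁ ℓ₂ : Level} (𝔽 : FiniteField q c ℓ₁ ℓ₂) where
  open FiniteField 𝔽 public
    using (commutativeRing; enumeration; _≟_; _#_; tight; #⇒invertible; invertible⇒#)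
  open CommutativeRing commutativeRing public hiding (zero) renaming (_+_ to _+ᶠ_; _*_ to _*ᶠ_)
  open Exp commutativeSemiring public
    using (^-homo-*; ^-congˡ; ^-congʳ) renaming (_^_ to _^ᶠ_)
  open SetoidReasoning setoid
  open Inverse enumeration using (strictlyInverseˡ; strictlyInverseʳ)
    renaming (to to element; from to index; from-cong to index-cong)
  open MonoidSum *-commutativeMonoid
    using ()
    renaming (sum to product; sum-cong-≋ to product-cong; sum-permute to product-permute;
              ∑-distrib-+ to product-distrib-*; sum-replicate to product-replicate)
  open RingProperties ring using (-0#≈0#)

  CharacteristicTwo : Set _
  CharacteristicTwo = ∀ x → x +ᶠ x ≈ 0#

  x-0≈x : ∀ x → x - 0# ≈ x
  x-0≈x x = trans (+-congˡ -0#≈0#) (+-identityʳ x)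

  -- If `1#` and `0#` coincided, all elements would, so the difference of `0#` with itself would be
  -- invertible and `0#` apart from itself.
  1≉0 : ¬ 1# ≈ 0#
  1≉0 1≈0 = proj₂ (tight 0# 0#) refl (invertible⇒# (0# , inv , inv))
    where
    inv : ∀ {x} → x ≈ 1#
    inv {x} = begin
      x       ≈⟨ *-identityʳ x ⟨
      x *ᶠ 1# ≈⟨ *-congˡ 1≈0 ⟩
      x *ᶠ 0# ≈⟨ zeroʳ x ⟩
      0#      ≈⟨ 1≈0 ⟨
      1#      ∎

  -- Only ¬ ¬ (x # 0#) is known, so the inverse is found by search.
  inverse : ∀ {x} → ¬ x ≈ 0# → ∃ λ y → x *ᶠ y ≈ 1#
  inverse {x} x≉0 with Fin.any? (λ i → x *ᶠ element i ≟ 1#)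
  ... | yes (i , e) = element i , e
  ... | no  ¬e      = contradiction (proj₁ (tight x 0#) ¬x#0) x≉0
    where
    ¬x#0 : ¬ x # 0#
    ¬x#0 x#0 with #⇒invertible x#0
    ... | y , _ , e = ¬e (index y , (begin
      x *ᶠ element (index y) ≈⟨ *-cong (sym (x-0≈x x)) (strictlyInverseˡ y) ⟩
      (x - 0#) *ᶠ y          ≈⟨ e ⟩
      1#                     ∎))

  *-cancelʳ : ∀ {x y z} → ¬ z ≈ 0# → x *ᶠ z ≈ y *ᶠ z → x ≈ y
  *-cancelʳ {x} {y} {z} z≉0 xz≈yz with inverse z≉0
  ... | w , zw≈1 = begin
    x             ≈⟨ lemma x ⟩
    (x *ᶠ z) *ᶠ w ≈⟨ *-congʳ xz≈yz ⟩
    (y *ᶠ z) *ᶠ w ≈⟨ lemma y ⟨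
    y             ∎
    where
    lemma : ∀ u → u ≈ (u *ᶠ z) *ᶠ w
    lemma u = begin
      u             ≈⟨ *-identityʳ u ⟨
      u *ᶠ 1#       ≈⟨ *-congˡ zw≈1 ⟨
      u *ᶠ (z *ᶠ w) ≈⟨ *-assoc u z w ⟨
      (u *ᶠ z) *ᶠ w ∎

  x*y≉0 : ∀ {x y} → ¬ x ≈ 0# → ¬ y ≈ 0# → ¬ x *ᶠ y ≈ 0#
  x*y≉0 x≉0 y≉0 xy≈0 = x≉0 (*-cancelʳ y≉0 (trans xy≈0 (sym (zeroˡ _))))

  product≉0 : ∀ {n} (f : Vector Carrier n) → (∀ i → ¬ f i ≈ 0#) → ¬ product f ≈ 0#
  product≉0 {zero}  f f≉0 = 1≉0
  product≉0 {suc n} f f≉0 = x*y≉0 (f≉0 zero) (product≉0 (f ∘ suc) (f≉0 ∘ suc))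

  private
    [_≈0]_,_ : Carrier → Carrier → Carrier → Carrier
    [ u ≈0] x , y with u ≟ 0#
    ... | yes _ = x
    ... | no  _ = y

  -- Multiplication by x permutes the non-zero elements, so their product is unchanged when
  -- each of them is multiplied by x; hence x ^ (q - 1) ≈ 1#. The extra factor x is the one
  -- contributed by the element 0#.
  x^q≈x : .{{NonZero q}} → ∀ x → x ^ᶠ q ≈ x
  x^q≈x x with x ≟ 0#
  ... | yes x≈0 = begin
    x ^ᶠ q  ≈⟨ ^-congˡ q x≈0 ⟩
    0# ^ᶠ q ≈⟨ 0^n≈0 q ⟩
    0#      ≈⟨ x≈0 ⟨
    x       ∎
    where
    0^n≈0 : ∀ n → .{{NonZero n}} → 0# ^ᶠ n ≈ 0#
    0^n≈0 (suc n) = zeroˡ _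
  ... | no x≉0 with inverse x≉0
  ... | x⁻¹ , xx⁻¹≈1 = begin
    x ^ᶠ q                          ≈⟨ product-replicate q ⟨
    product {q} (λ _ → x)           ≈⟨ product-cong {q} split ⟩
    product (λ i → nz i *ᶠ z i)     ≈⟨ product-distrib-* nz z ⟩
    product nz *ᶠ product z         ≈⟨ *-cong ∏nz≈1 ∏z≈x ⟩
    1# *ᶠ x                         ≈⟨ *-identityˡ x ⟩
    x                               ∎
    where
    -- All products run over the whole of `Fin q`: `g` puts the neutral `1#` in the place of `0#`,
    -- and `nz` and `z` split the q factors x into those of the non-zero elements and that of `0#`.
    g nz z : Fin q → Carrier
    g  i = [ element i ≈0] 1# , element i
    nz i = [ element i ≈0] 1# , x
    z  i = [ element i ≈0] x , 1#

    g≉0 : ∀ i → ¬ g i ≈ 0#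
    g≉0 i with element i ≟ 0#
    ... | yes _ = 1≉0
    ... | no e≉0 = e≉0

    split : ∀ i → x ≈ nz i *ᶠ z i
    split i with element i ≟ 0#
    ... | yes _ = sym (*-identityˡ x)
    ... | no  _ = sym (*-identityʳ x)

    scale : Carrier → Fin q → Fin q
    scale u i = index (u *ᶠ element i)

    scale-inverse : ∀ {u v} → u *ᶠ v ≈ 1# → ∀ i → scale u (scale v i) ≡ i
    scale-inverse {u} {v} uv≈1 i = ≡.trans (index-cong (begin
      u *ᶠ element (scale v i) ≈⟨ *-congˡ (strictlyInverseˡ _) ⟩
      u *ᶠ (v *ᶠ element i)    ≈⟨ *-assoc u v _ ⟨
      (u *ᶠ v) *ᶠ element i    ≈⟨ *-congʳ uv≈1 ⟩
      1# *ᶠ element i          ≈⟨ *-identityˡ _ ⟩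
      element i                ∎)) (strictlyInverseʳ i)

    scaled : ∀ i → g (scale x i) ≈ nz i *ᶠ g i
    scaled i with element i ≟ 0# | element (scale x i) ≟ 0#
    ... | yes _ | yes _ = sym (*-identityˡ 1#)
    ... | yes e≈0 | no se≉0 = contradiction
      (trans (strictlyInverseˡ _) (trans (*-congˡ e≈0) (zeroʳ x))) se≉0
    ... | no e≉0 | yes se≈0 = contradiction (trans (sym (strictlyInverseˡ _)) se≈0) (x*y≉0 x≉0 e≉0)
    ... | no _ | no _ = strictlyInverseˡ _

    ∏nz≈1 : product nz ≈ 1#
    ∏nz≈1 = *-cancelʳ (product≉0 g g≉0) (begin
      product nz *ᶠ product g        ≈⟨ product-distrib-* nz g ⟨
      product (λ i → nz i *ᶠ g i)    ≈⟨ product-cong scaled ⟨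
      product (λ i → g (scale x i))  ≈⟨ product-permute g
                                          (permutation (scale x) (scale x⁻¹)
                                            (scale-inverse xx⁻¹≈1)
                                            (scale-inverse (trans (*-comm x⁻¹ x) xx⁻¹≈1))) ⟨
      product g                      ≈⟨ *-identityˡ _ ⟨
      1# *ᶠ product g                ∎)

    i₀ : Fin q
    i₀ = index 0#

    ∏z≈x : product z ≈ x
    ∏z≈x = trans (sum-support *-commutativeMonoid z i₀ others) at-i₀
      where
      others : ∀ j → j ≢ i₀ → z j ≈ 1#
      others j j≢i₀ with element j ≟ 0#
      ... | yes e≈0 = contradiction
        (≡.trans (≡.sym (strictlyInverseʳ j)) (index-cong e≈0)) j≢i₀
      ... | no _ = refl
      at-i₀ : z i₀ ≈ x
      at-i₀ with element i₀ ≟ 0#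
      ... | yes _ = refl
      ... | no e≉0 = contradiction (strictlyInverseˡ 0#) e≉0

-- The trace: values in the prime field, additivity, non-vanishing

module TraceProperties {k : ℕ} {c ℓ₁ ℓ₂ : Level} (𝔽 : FiniteField (2 ^ k) c ℓ₁ ℓ₂)
  (x+x≈0 : FiniteFieldProperties.CharacteristicTwo 𝔽) where

  open FiniteFieldProperties 𝔽
  open Polynomial commutativeRing
  open SetoidReasoning setoid
  open SemiringSolver commutativeSemiring using (solve; _:+_; _:*_; _:=_)
  open Inverse enumeration using (strictlyInverseʳ)
    renaming (to to element; from to index; from-cong to index-cong)
  open MonoidSum +-commutativeMonoid using (sum; sum-cong-≋; ∑-distrib-+; sum-init-last)

  private
    instance
      2^k≢0 : NonZero (2 ^ k)
      2^k≢0 = ℕ.m^n≢0 2 k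

    trace′ : Carrier → Carrier
    trace′ = trace {k} 𝔽

    Tr′ : Carrier → Bool
    Tr′ = Tr {k} 𝔽

    fromBool′ : Bool → Carrier
    fromBool′ = fromBool {k} 𝔽

  partialTrace : ℕ → Carrier → Carrier
  partialTrace n x = sum {n} (λ i → x ^ᶠ (2 ^ toℕ i))

  partialTrace-suc : ∀ n x → partialTrace (suc n) x ≈ partialTrace n x +ᶠ x ^ᶠ (2 ^ n)
  partialTrace-suc n x = trans (sum-init-last {n} (λ i → x ^ᶠ (2 ^ toℕ i)))
    (+-cong (sum-cong-≋ {n} (λ i → ^-congʳ x (≡.cong (2 ^_) (Fin.toℕ-inject₁ i))))
            (^-congʳ x (≡.cong (2 ^_) (Fin.toℕ-fromℕ n))))

  square-+ : ∀ x y → (x +ᶠ y) *ᶠ (x +ᶠ y) ≈ x *ᶠ x +ᶠ y *ᶠ y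
  square-+ x y = begin
    (x +ᶠ y) *ᶠ (x +ᶠ y)
      ≈⟨ solve 2 (λ x y → (x :+ y) :* (x :+ y)
                        := (x :* x :+ y :* y) :+ (x :* y :+ x :* y)) refl x y ⟩
    (x *ᶠ x +ᶠ y *ᶠ y) +ᶠ (x *ᶠ y +ᶠ x *ᶠ y)
      ≈⟨ +-congˡ (x+x≈0 (x *ᶠ y)) ⟩
    (x *ᶠ x +ᶠ y *ᶠ y) +ᶠ 0#
      ≈⟨ +-identityʳ _ ⟩
    x *ᶠ x +ᶠ y *ᶠ y ∎

  ^2^suc : ∀ n x → x ^ᶠ (2 ^ suc n) ≈ x ^ᶠ (2 ^ n) *ᶠ x ^ᶠ (2 ^ n)
  ^2^suc n x = trans (^-congʳ x (≡.cong (λ m → 2 ^ n + m) (ℕ.+-identityʳ (2 ^ n))))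
                     (^-homo-* x (2 ^ n) (2 ^ n))

  frobenius-+ : ∀ n x y → (x +ᶠ y) ^ᶠ (2 ^ n) ≈ x ^ᶠ (2 ^ n) +ᶠ y ^ᶠ (2 ^ n)
  frobenius-+ zero    x y =
    trans (*-identityʳ _) (sym (+-cong (*-identityʳ x) (*-identityʳ y)))
  frobenius-+ (suc n) x y = begin
    (x +ᶠ y) ^ᶠ (2 ^ suc n)
      ≈⟨ ^2^suc n (x +ᶠ y) ⟩
    (x +ᶠ y) ^ᶠ (2 ^ n) *ᶠ (x +ᶠ y) ^ᶠ (2 ^ n)
      ≈⟨ *-cong (frobenius-+ n x y) (frobenius-+ n x y) ⟩
    (x ^ᶠ (2 ^ n) +ᶠ y ^ᶠ (2 ^ n)) *ᶠ (x ^ᶠ (2 ^ n) +ᶠ y ^ᶠ (2 ^ n))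
      ≈⟨ square-+ _ _ ⟩
    x ^ᶠ (2 ^ n) *ᶠ x ^ᶠ (2 ^ n) +ᶠ y ^ᶠ (2 ^ n) *ᶠ y ^ᶠ (2 ^ n)
      ≈⟨ +-cong (^2^suc n x) (^2^suc n y) ⟨
    x ^ᶠ (2 ^ suc n) +ᶠ y ^ᶠ (2 ^ suc n) ∎

  trace-+ : ∀ x y → trace′ (x +ᶠ y) ≈ trace′ x +ᶠ trace′ y
  trace-+ x y = trans (sum-cong-≋ {k} (λ i → frobenius-+ (toℕ i) x y))
                      (∑-distrib-+ {k} (λ i → x ^ᶠ (2 ^ toℕ i)) (λ i → y ^ᶠ (2 ^ toℕ i)))

  trace-cong : ∀ {x y} → x ≈ y → trace′ x ≈ trace′ y
  trace-cong x≈y = sum-cong-≋ {k} (λ i → ^-congˡ (2 ^ toℕ i) x≈y)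

  -- Squaring shifts the sum by one term.
  partialTrace-square : ∀ n x → partialTrace n x *ᶠ partialTrace n x +ᶠ x
                              ≈ partialTrace n x +ᶠ x ^ᶠ (2 ^ n)
  partialTrace-square zero    x = +-cong (zeroˡ 0#) (sym (*-identityʳ x))
  partialTrace-square (suc n) x = begin
    T′ *ᶠ T′ +ᶠ x             ≈⟨ +-congʳ (*-cong (partialTrace-suc n x) (partialTrace-suc n x)) ⟩
    (T +ᶠ L) *ᶠ (T +ᶠ L) +ᶠ x ≈⟨ +-congʳ (square-+ T L) ⟩
    (T *ᶠ T +ᶠ L *ᶠ L) +ᶠ x   ≈⟨ solve 3 (λ u v x → (u :+ v) :+ x := (u :+ x) :+ v)
                                        refl (T *ᶠ T) (L *ᶠ L) x ⟩
    (T *ᶠ T +ᶠ x) +ᶠ L *ᶠ L   ≈⟨ +-cong (partialTrace-square n x) (sym (^2^suc n x)) ⟩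
    (T +ᶠ L) +ᶠ x ^ᶠ (2 ^ suc n) ≈⟨ +-congʳ (partialTrace-suc n x) ⟨
    T′ +ᶠ x ^ᶠ (2 ^ suc n)    ∎
    where
    T  = partialTrace n x
    T′ = partialTrace (suc n) x
    L  = x ^ᶠ (2 ^ n)

  +-cancelʳ : ∀ {x y} z → x +ᶠ z ≈ y +ᶠ z → x ≈ y
  +-cancelʳ z = RingProperties.+-cancelʳ ring z _ _

  -- In `partialTrace-square` at `k`, the term that the shift brings in, x^(2^k), equals by `x^q≈x`
  -- the term x that it drops. A solution of t² = t in a field is 0 or 1.
  trace-idem : ∀ x → trace′ x *ᶠ trace′ x ≈ trace′ x
  trace-idem x = +-cancelʳ x (trans (partialTrace-square k x) (+-congˡ (x^q≈x x)))

  trace∈𝔽₂ : ∀ x → ∃ λ b → trace′ x ≈ fromBool′ b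
  trace∈𝔽₂ x with trace′ x ≟ 0#
  ... | yes t≈0 = false , t≈0
  ... | no  t≉0 = true , *-cancelʳ t≉0 (trans (trace-idem x) (sym (*-identityˡ _)))

  -- Lets Boolean identities for `Tr` be proved as identities between field elements.
  Tr-unique : ∀ x b → trace′ x ≈ fromBool′ b → Tr′ x ≡ b
  Tr-unique x true  t≈1 = dec-true (trace′ x ≟ 1#) t≈1
  Tr-unique x false t≈0 = dec-false (trace′ x ≟ 1#) (λ t≈1 → 1≉0 (trans (sym t≈1) t≈0))

  trace≈Tr : ∀ x → trace′ x ≈ fromBool′ (Tr′ x)
  trace≈Tr x with trace∈𝔽₂ x
  ... | b , t≈b = trans t≈b (reflexive (≡.cong fromBool′ (≡.sym (Tr-unique x b t≈b))))

  Tr-cong : ∀ {x y} → x ≈ y → Tr′ x ≡ Tr′ y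
  Tr-cong {x} {y} x≈y = Tr-unique x (Tr′ y) (trans (trace-cong x≈y) (trace≈Tr y))

  fromBool-xor : ∀ b b′ → fromBool′ b +ᶠ fromBool′ b′ ≈ fromBool′ (b xor b′)
  fromBool-xor false b′    = +-identityˡ _
  fromBool-xor true  false = +-identityʳ 1#
  fromBool-xor true  true  = x+x≈0 1#

  Tr-+ : ∀ x y → Tr′ (x +ᶠ y) ≡ Tr′ x xor Tr′ y
  Tr-+ x y = Tr-unique (x +ᶠ y) (Tr′ x xor Tr′ y) (begin
    trace′ (x +ᶠ y)                            ≈⟨ trace-+ x y ⟩
    trace′ x +ᶠ trace′ y                      ≈⟨ +-cong (trace≈Tr x) (trace≈Tr y) ⟩
    fromBool′ (Tr′ x) +ᶠ fromBool′ (Tr′ y)  ≈⟨ fromBool-xor _ _ ⟩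
    fromBool′ (Tr′ x xor Tr′ y)              ∎)

  private
    -- Serves two counts: the room for padding a degree in `partialTrace-Poly`, and the 2^n + 1
    -- distinct field elements set against a degree of 2^n in `trace-nontrivial`.
    1+2^n≤2^[1+n] : ∀ n → suc (2 ^ n) ≤ 2 ^ suc n
    1+2^n≤2^[1+n] n = ℕ.^-monoʳ-< 2 (s≤s (s≤s z≤n)) (ℕ.n<1+n n)

  mutual
    -- All exponents in `partialTrace n` are below 2^n, so its coefficient in degree 2^n is `0#`.
    -- Adding x^(2^n) then gives a monic polynomial, and padding that one up to degree 2^(n+1)
    -- closes the mutual induction.
    partialTrace-Poly : ∀ n → Poly 0# (2 ^ n) (partialTrace n)
    partialTrace-Poly zero    = Poly-0# 1
    partialTrace-Poly (suc n) = ≡.subst (λ d → Poly 0# d (partialTrace (suc n)))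
      (ℕ.m∸n+n≡m (1+2^n≤2^[1+n] n))
      (Poly-+ˡ (2 ^ suc n ∸ suc (2 ^ n)) (Poly-suc (2 ^ n) (partialTrace-monic n)))

    partialTrace-monic : ∀ n → Poly 1# (2 ^ n) (partialTrace (suc n))
    partialTrace-monic n = Poly-resp (2 ^ n) (+-identityˡ 1#) (λ x → sym (partialTrace-suc n x))
      (Poly-+ (2 ^ n) (partialTrace-Poly n) (Poly-^ (2 ^ n)))

  -- Otherwise a monic polynomial of degree 2^(k-1) would vanish on the whole field; 2^(k-1) + 1 of
  -- its elements already give a contradiction.
  trace-nontrivial : 1 ≤ k → ∃ λ x → Tr′ x ≡ true
  trace-nontrivial 1≤k with Fin.any? (λ i → trace′ (element i) ≟ 1#)
  ... | yes (i , t≈1) = element i , Tr-unique (element i) true t≈1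
  ... | no  ¬∃        = contradiction vanishes (¬vanishes k ≡.refl 1≤k)
    where
    vanishes : ∀ i → partialTrace k (element i) ≈ 0#
    vanishes i = trans (trace≈Tr _)
      (reflexive (≡.cong (fromBool′) (dec-false (_ ≟ _) (λ t≈1 → ¬∃ (i , t≈1)))))

    -- Writing `k` as `suc n` exposes the top term x^(2^n), which makes the trace monic.
    ¬vanishes : ∀ n → n ≡ k → 1 ≤ n → ¬ (∀ i → partialTrace n (element i) ≈ 0#)
    ¬vanishes (suc n) ≡.refl _ root =
      ¬too-many-roots *-cancelʳ 1≉0 _≟_ (2 ^ n) (partialTrace-monic n)
        (λ i → element (inject≤ i (1+2^n≤2^[1+n] n)))
        (λ i j e → Fin.inject≤-injective _ _ i j
          (≡.trans (≡.sym (strictlyInverseʳ _)) (≡.trans (index-cong e) (strictlyInverseʳ _))))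
        (λ i → root _)

-- The trilinear form Tr(φ(x)φ(y)φ(z))

module TraceProductProperties {k : ℕ} {c ℓ₁ ℓ₂ : Level} (𝔽 : FiniteField (2 ^ k) c ℓ₁ ℓ₂)
  (φ : 𝔽₂^ k → FiniteField.Carrier 𝔽) (φ-iso : IsLinearIsomorphism 𝔽 φ) where

  open FiniteFieldProperties 𝔽
  open SetoidReasoning setoid
  open LeftModuleMorphisms (𝔽₂^-rawModule k) (𝔽-rawModule {k} 𝔽)
    using (module IsLeftModuleIsomorphism)
  open IsLeftModuleIsomorphism φ-iso using (+ᴹ-homo; 0ᴹ-homo; injective; surjective)
  open SemiringSolver commutativeSemiring using (solve; _:+_; _:*_; _:=_)

  private
    φ⁻¹ : ∀ x → ∃ λ v → φ v ≈ x
    φ⁻¹ x with surjective x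
    ... | v , e = v , e ≡.refl

  -- `FiniteField` fixes only the number of elements; the characteristic is carried over from the
  -- vector space through `φ`.
  x+x≈0 : CharacteristicTwo
  x+x≈0 x with φ⁻¹ x
  ... | v , φv≈x = begin
    x +ᶠ x      ≈⟨ +-cong φv≈x φv≈x ⟨
    φ v +ᶠ φ v  ≈⟨ +ᴹ-homo v v ⟨
    φ (v ⊕ v)   ≡⟨ ≡.cong φ (⊕-self v) ⟩
    φ 𝟎         ≈⟨ 0ᴹ-homo ⟩
    0#          ∎

  open TraceProperties {k} 𝔽 x+x≈0

  private
    t : 𝔽₂^ k → 𝔽₂^ k → 𝔽₂^ k → Bool
    t = traceProduct 𝔽 φ

    φ≉0 : ∀ {v} → v ≢ 𝟎 → ¬ φ v ≈ 0#
    φ≉0 v≢𝟎 φv≈0 = v≢𝟎 (injective (trans φv≈0 (sym 0ᴹ-homo)))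

  traceProduct-swap₁₂ : ∀ x y z → t x y z ≡ t y x z
  traceProduct-swap₁₂ x y z = Tr-cong (*-congʳ (*-comm (φ x) (φ y)))

  traceProduct-swap₂₃ : ∀ x y z → t x y z ≡ t x z y
  traceProduct-swap₂₃ x y z =
    Tr-cong (solve 3 (λ x y z → (x :* y) :* z := (x :* z) :* y) refl (φ x) (φ y) (φ z))

  traceProduct-additive : ∀ x x′ y z → t (x ⊕ x′) y z ≡ t x y z xor t x′ y z
  traceProduct-additive x x′ y z = ≡.trans
    (Tr-cong (trans (*-congʳ (*-congʳ (+ᴹ-homo x x′)))
      (solve 4 (λ x x′ y z → ((x :+ x′) :* y) :* z := (x :* y) :* z :+ (x′ :* y) :* z)
             refl (φ x) (φ x′) (φ y) (φ z))))
    (Tr-+ _ _)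

  -- Choose y with φ(y) = u / (φ(x)φ(z)), where u has trace 1: the product of the three factors is
  -- then u.
  traceProduct-nondegenerate : 1 ≤ k → ∀ {x z} → x ≢ 𝟎 → z ≢ 𝟎 → ∃ λ y → t x y z ≡ true
  traceProduct-nondegenerate 1≤k {x} {z} x≢𝟎 z≢𝟎
    with trace-nontrivial 1≤k | inverse (x*y≉0 (φ≉0 x≢𝟎) (φ≉0 z≢𝟎))
  ... | u , Tr-u | w , xzw≈1 with φ⁻¹ (w *ᶠ u)
  ... | y , φy≈wu = y , ≡.trans (Tr-cong (begin
    (φ x *ᶠ φ y) *ᶠ φ z         ≈⟨ *-congʳ (*-congˡ φy≈wu) ⟩
    (φ x *ᶠ (w *ᶠ u)) *ᶠ φ z    ≈⟨ solve 4 (λ x z w u → (x :* (w :* u)) :* z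
                                                       := ((x :* z) :* w) :* u) refl (φ x) (φ z) w u ⟩
    ((φ x *ᶠ φ z) *ᶠ w) *ᶠ u    ≈⟨ *-congʳ xzw≈1 ⟩
    1# *ᶠ u                     ≈⟨ *-identityˡ u ⟩
    u                           ∎)) Tr-u

-- Vectors over the two-element field and integer sums over them

open ≡ using (refl; sym; trans; cong; cong₂; subst; subst₂; module ≡-Reasoning)

private
  variable
    k m n d : ℕ

⊕-assoc : (u v w : 𝔽₂^ n) → (u ⊕ v) ⊕ w ≡ u ⊕ (v ⊕ w)
⊕-assoc = Vec.zipWith-assoc Bool.xor-assoc

⊕-comm : (u v : 𝔽₂^ n) → u ⊕ v ≡ v ⊕ u
⊕-comm = Vec.zipWith-comm Bool.xor-comm

⊕-identityˡ : (v : 𝔽₂^ n) → 𝟎 ⊕ v ≡ v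
⊕-identityˡ = Vec.zipWith-identityˡ Bool.xor-identityˡ

⊕-identityʳ : (v : 𝔽₂^ n) → v ⊕ 𝟎 ≡ v
⊕-identityʳ = Vec.zipWith-identityʳ Bool.xor-identityʳ

⊕-cancelʳ : (u v : 𝔽₂^ n) → (u ⊕ v) ⊕ v ≡ u
⊕-cancelʳ u v = trans (⊕-assoc u v v) (trans (cong (u ⊕_) (⊕-self v)) (⊕-identityʳ u))

⊕-cancelˡ : (u v : 𝔽₂^ n) → (u ⊕ u) ⊕ v ≡ v
⊕-cancelˡ u v = trans (cong (_⊕ v) (⊕-self u)) (⊕-identityˡ v)

⊕≡𝟎⇒≡ : (u v : 𝔽₂^ n) → u ⊕ v ≡ 𝟎 → u ≡ v
⊕≡𝟎⇒≡ u v e = trans (sym (⊕-cancelʳ u v)) (trans (cong (_⊕ v) e) (⊕-identityˡ v))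

⊕-commutativeSemigroup : ℕ → CommutativeSemigroup _ _
⊕-commutativeSemigroup n = record
  { _∙_ = _⊕_ {n}
  ; isCommutativeSemigroup = record
    { isSemigroup = record
      { isMagma = isMagma _⊕_
      ; assoc   = ⊕-assoc
      }
    ; comm = ⊕-comm
    }
  }

module ⊕ {n} = CommutativeSemigroupProperties (⊕-commutativeSemigroup n)

search : (p : 𝔽₂^ n → Bool) → (∃ λ v → p v ≡ true) ⊎ (∀ v → p v ≡ false)
search {zero} p with p [] in e
... | true  = inj₁ ([] , e)
... | false = inj₂ λ where [] → e
search {suc n} p with search (p ∘ (false ∷_)) | search (p ∘ (true ∷_))
... | inj₁ (v , e) | _            = inj₁ (false ∷ v , e)
... | inj₂ _       | inj₁ (v , e) = inj₁ (true ∷ v , e)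
... | inj₂ e       | inj₂ e′      = inj₂ λ where
  (false ∷ v) → e v
  (true ∷ v)  → e′ v

-- Recursion on coordinates makes translation, exchange and splitting of sums plain inductions;
-- `sum-elements` connects it with the lists in the definition of bias.
∑ : (𝔽₂^ n → ℤ) → ℤ
∑ {zero}  g = g []
∑ {suc n} g = ∑ (g ∘ (false ∷_)) ℤ.+ ∑ (g ∘ (true ∷_))

∑-cong : {g h : 𝔽₂^ n → ℤ} → g ≗ h → ∑ g ≡ ∑ h
∑-cong {zero}  g≗h = g≗h []
∑-cong {suc n} g≗h = cong₂ ℤ._+_ (∑-cong (g≗h ∘ (false ∷_))) (∑-cong (g≗h ∘ (true ∷_)))

∑-+ : (g h : 𝔽₂^ n → ℤ) → ∑ (λ v → g v ℤ.+ h v) ≡ ∑ g ℤ.+ ∑ h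
∑-+ {zero}  g h = refl
∑-+ {suc n} g h = trans (cong₂ ℤ._+_ (∑-+ (g ∘ (false ∷_)) (h ∘ (false ∷_)))
                                     (∑-+ (g ∘ (true ∷_)) (h ∘ (true ∷_))))
                        (interchange (∑ (g ∘ (false ∷_))) _ _ _)
  where open CommutativeSemigroupProperties ℤ.+-commutativeSemigroup using (interchange)

∑-*ʳ : (g : 𝔽₂^ n → ℤ) (i : ℤ) → ∑ (λ v → g v ℤ.* i) ≡ ∑ g ℤ.* i
∑-*ʳ {zero}  g i = refl
∑-*ʳ {suc n} g i = trans (cong₂ ℤ._+_ (∑-*ʳ (g ∘ (false ∷_)) i) (∑-*ʳ (g ∘ (true ∷_)) i))
                         (sym (ℤ.*-distribʳ-+ i (∑ (g ∘ (false ∷_))) (∑ (g ∘ (true ∷_)))))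

∑-const : ∀ n (j : ℕ) → ∑ {n} (λ _ → + j) ≡ + (2 ^ n * j)
∑-const zero    j = cong +_ (sym (ℕ.*-identityˡ j))
∑-const (suc n) j = trans (cong₂ ℤ._+_ (∑-const n j) (∑-const n j)) (cong +_ (begin
  2 ^ n * j + 2 ^ n * j ≡⟨ ℕ.*-distribʳ-+ j (2 ^ n) (2 ^ n) ⟨
  (2 ^ n + 2 ^ n) * j   ≡⟨ cong (λ i → (2 ^ n + i) * j) (ℕ.+-identityʳ (2 ^ n)) ⟨
  2 ^ suc n * j         ∎))
  where open ≡-Reasoning

∑-comm : (g : 𝔽₂^ m → 𝔽₂^ n → ℤ) → ∑ (λ u → ∑ (g u)) ≡ ∑ (λ v → ∑ (λ u → g u v))
∑-comm {zero}  g = refl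
∑-comm {suc m} g = trans (cong₂ ℤ._+_ (∑-comm (g ∘ (false ∷_))) (∑-comm (g ∘ (true ∷_))))
                         (sym (∑-+ (λ v → ∑ (λ u → g (false ∷ u) v))
                                   (λ v → ∑ (λ u → g (true ∷ u) v))))

∑-++ : ∀ {n} m (g : 𝔽₂^ (m + n) → ℤ) → ∑ g ≡ ∑ {m} (λ u → ∑ {n} (λ v → g (u ++ v)))
∑-++ zero    g = refl
∑-++ (suc m) g = cong₂ ℤ._+_ (∑-++ m (g ∘ (false ∷_))) (∑-++ m (g ∘ (true ∷_)))

-- Each coordinate `true` of `a` swaps the two halves of the sum.
∑-shift : (a : 𝔽₂^ n) (g : 𝔽₂^ n → ℤ) → ∑ (λ v → g (v ⊕ a)) ≡ ∑ g
∑-shift []          g = refl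
∑-shift (false ∷ a) g = cong₂ ℤ._+_ (∑-shift a (g ∘ (false ∷_))) (∑-shift a (g ∘ (true ∷_)))
∑-shift (true ∷ a)  g = trans (cong₂ ℤ._+_ (∑-shift a (g ∘ (true ∷_))) (∑-shift a (g ∘ (false ∷_))))
                              (ℤ.+-comm (∑ (g ∘ (true ∷_))) _)

∑-zero : (g : 𝔽₂^ n → ℤ) → (∀ v → g v ≡ 0ℤ) → ∑ g ≡ 0ℤ
∑-zero {zero}  g g≡0 = g≡0 []
∑-zero {suc n} g g≡0 = cong₂ ℤ._+_ (∑-zero _ (g≡0 ∘ (false ∷_))) (∑-zero _ (g≡0 ∘ (true ∷_)))

∑-support : (g : 𝔽₂^ n → ℤ) (u : 𝔽₂^ n) → (∀ v → v ≢ u → g v ≡ 0ℤ) → ∑ g ≡ g u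
∑-support g []          _   = refl
∑-support g (false ∷ u) g≡0 = trans
  (cong₂ ℤ._+_ (∑-support (g ∘ (false ∷_)) u (λ v v≢u → g≡0 _ (v≢u ∘ Vec.∷-injectiveʳ)))
               (∑-zero (g ∘ (true ∷_)) (λ v → g≡0 _ λ ())))
  (ℤ.+-identityʳ _)
∑-support g (true ∷ u)  g≡0 = trans
  (cong₂ ℤ._+_ (∑-zero (g ∘ (false ∷_)) (λ v → g≡0 _ λ ()))
               (∑-support (g ∘ (true ∷_)) u (λ v v≢u → g≡0 _ (v≢u ∘ Vec.∷-injectiveʳ))))
  (ℤ.+-identityˡ _)

∑-mono-≤ : {g h : 𝔽₂^ n → ℤ} → (∀ v → g v ℤ.≤ h v) → ∑ g ℤ.≤ ∑ h
∑-mono-≤ {zero}  g≤h = g≤h []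
∑-mono-≤ {suc n} g≤h = ℤ.+-mono-≤ (∑-mono-≤ (g≤h ∘ (false ∷_))) (∑-mono-≤ (g≤h ∘ (true ∷_)))

∣∑∣≤∑∣∣ : (g : 𝔽₂^ n → ℤ) → + ∣ ∑ g ∣ ℤ.≤ ∑ (λ v → + ∣ g v ∣)
∣∑∣≤∑∣∣ {zero}  g = ℤ.≤-refl
∣∑∣≤∑∣∣ {suc n} g = ℤ.≤-trans (ℤ.+≤+ (ℤ.∣i+j∣≤∣i∣+∣j∣ (∑ (g ∘ (false ∷_))) _))
  (ℤ.+-mono-≤ (∣∑∣≤∑∣∣ (g ∘ (false ∷_))) (∣∑∣≤∑∣∣ (g ∘ (true ∷_))))

∣∑∣≤ : {g h : 𝔽₂^ n → ℤ} → (∀ v → + ∣ g v ∣ ℤ.≤ h v) → + ∣ ∑ g ∣ ℤ.≤ ∑ h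
∣∑∣≤ {g = g} ∣g∣≤h = ℤ.≤-trans (∣∑∣≤∑∣∣ g) (∑-mono-≤ ∣g∣≤h)

-- Characters and twisted sums

χ : Bool → ℤ
χ b = if b then -1ℤ else 1ℤ

⟦_⟧ : Bool → ℤ
⟦ b ⟧ = if b then 1ℤ else 0ℤ

χ-xor : ∀ b b′ → χ (b xor b′) ≡ χ b ℤ.* χ b′
χ-xor false b′    = sym (ℤ.*-identityˡ (χ b′))
χ-xor true  false = refl
χ-xor true  true  = refl

∣χ∣≡1 : ∀ b → ∣ χ b ∣ ≡ 1
∣χ∣≡1 false = refl
∣χ∣≡1 true  = refl

i≡-i⇒i≡0 : ∀ {i} → i ≡ ℤ.- i → i ≡ 0ℤ
i≡-i⇒i≡0 {+ zero} _ = refl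

Additive : (𝔽₂^ n → Bool) → Set
Additive l = ∀ u v → l (u ⊕ v) ≡ l u xor l v

-- Translating by u flips the sign of every summand.
twisted-sum≡0 : (p l : 𝔽₂^ n → Bool) → Additive l → ∀ u → (∀ v → p (v ⊕ u) ≡ p v) →
                l u ≡ true → ∑ (λ v → ⟦ p v ⟧ ℤ.* χ (l v)) ≡ 0ℤ
twisted-sum≡0 p l l-+ u p-u lu = i≡-i⇒i≡0 (begin
  ∑ g                        ≡⟨ ∑-shift u g ⟨
  ∑ (λ v → g (v ⊕ u))        ≡⟨ ∑-cong flips ⟩
  ∑ (λ v → g v ℤ.* -1ℤ)      ≡⟨ ∑-*ʳ g -1ℤ ⟩
  ∑ g ℤ.* -1ℤ                ≡⟨ ℤ.*-comm (∑ g) -1ℤ ⟩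
  -1ℤ ℤ.* ∑ g                ≡⟨ ℤ.-1*i≡-i (∑ g) ⟩
  ℤ.- ∑ g                    ∎)
  where
  open ≡-Reasoning
  g : 𝔽₂^ _ → ℤ
  g v = ⟦ p v ⟧ ℤ.* χ (l v)
  flips : ∀ v → g (v ⊕ u) ≡ g v ℤ.* -1ℤ
  flips v = begin
    ⟦ p (v ⊕ u) ⟧ ℤ.* χ (l (v ⊕ u))    ≡⟨ cong₂ (λ b b′ → ⟦ b ⟧ ℤ.* χ b′) (p-u v) (l-+ v u) ⟩
    ⟦ p v ⟧ ℤ.* χ (l v xor l u)        ≡⟨ cong (λ b → ⟦ p v ⟧ ℤ.* χ (l v xor b)) lu ⟩
    ⟦ p v ⟧ ℤ.* χ (l v xor true)       ≡⟨ cong (⟦ p v ⟧ ℤ.*_) (χ-xor (l v) true) ⟩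
    ⟦ p v ⟧ ℤ.* (χ (l v) ℤ.* -1ℤ)      ≡⟨ ℤ.*-assoc ⟦ p v ⟧ (χ (l v)) -1ℤ ⟨
    g v ℤ.* -1ℤ                        ∎

-- If `l` is true somewhere on the set given by `p`, translation by that point cancels the sum to 0;
-- otherwise every term is 0 or 1.
twisted-sum≥0 : (p l : 𝔽₂^ n → Bool) → Additive l →
                (∀ u → p u ≡ true → ∀ v → p (v ⊕ u) ≡ p v) →
                0ℤ ℤ.≤ ∑ (λ v → ⟦ p v ⟧ ℤ.* χ (l v))
twisted-sum≥0 {n} p l l-+ p-+ with search (λ v → p v ∧ l v)
... | inj₁ (u , e) = ℤ.≤-reflexive
  (sym (twisted-sum≡0 p l l-+ u (p-+ u (proj₁ (∧-true e))) (proj₂ (∧-true e))))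
  where
  ∧-true : ∀ {b b′} → b ∧ b′ ≡ true → b ≡ true × b′ ≡ true
  ∧-true {true} {true} _ = refl , refl
... | inj₂ e = subst (ℤ._≤ ∑ g) (∑-zero {n} (λ _ → 0ℤ) (λ _ → refl))
  (∑-mono-≤ (λ v → g≥0 (p v) (l v) (e v)))
  where
  g : 𝔽₂^ n → ℤ
  g v = ⟦ p v ⟧ ℤ.* χ (l v)
  g≥0 : ∀ b b′ → b ∧ b′ ≡ false → 0ℤ ℤ.≤ ⟦ b ⟧ ℤ.* χ b′
  g≥0 false b′    _ = ℤ.≤-refl
  g≥0 true  false _ = ℤ.+≤+ z≤n

-- Symmetric trilinear forms and the fibre estimate

≡true-ext : ∀ {b b′} → (b ≡ true → b′ ≡ true) → (b′ ≡ true → b ≡ true) → b ≡ b′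
≡true-ext {false} {false} f g = refl
≡true-ext {false} {true}  f g = g refl
≡true-ext {true}          f g = sym (f refl)

-- The interface between field and counting: the estimates below know the trace product only through
-- these properties.
record SymmetricTrilinear (t : 𝔽₂^ k → 𝔽₂^ k → 𝔽₂^ k → Bool) : Set where
  field
    swap₁₂        : ∀ x y z → t x y z ≡ t y x z
    swap₂₃        : ∀ x y z → t x y z ≡ t x z y
    additive₁     : ∀ x x′ y z → t (x ⊕ x′) y z ≡ t x y z xor t x′ y z
    nondegenerate : ∀ {x z} → x ≢ 𝟎 → z ≢ 𝟎 → ∃ λ y → t x y z ≡ true

  swap₁₃ : ∀ x y z → t x y z ≡ t z y x
  swap₁₃ x y z = trans (swap₁₂ x y z) (trans (swap₂₃ y x z) (swap₁₂ y z x))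

  additive₂ : ∀ x y y′ z → t x (y ⊕ y′) z ≡ t x y z xor t x y′ z
  additive₂ x y y′ z = trans (swap₁₂ x (y ⊕ y′) z)
    (trans (additive₁ y y′ x z) (cong₂ _xor_ (swap₁₂ y x z) (swap₁₂ y′ x z)))

  additive₃ : ∀ x y → Additive (t x y)
  additive₃ x y z z′ = trans (swap₂₃ x y (z ⊕ z′))
    (trans (additive₂ x z z′ y) (cong₂ _xor_ (swap₂₃ x z y) (swap₂₃ x z′ y)))

Additive⇒𝟎 : (l : 𝔽₂^ n → Bool) → Additive l → l 𝟎 ≡ false
Additive⇒𝟎 l l-+ = begin
  l 𝟎            ≡⟨ cong l (⊕-self 𝟎) ⟨
  l (𝟎 ⊕ 𝟎)      ≡⟨ l-+ 𝟎 𝟎 ⟩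
  l 𝟎 xor l 𝟎    ≡⟨ Bool.xor-same (l 𝟎) ⟩
  false          ∎
  where open ≡-Reasoning

Additive-xor : (l l′ : 𝔽₂^ n → Bool) → Additive l → Additive l′ → Additive (λ v → l v xor l′ v)
Additive-xor l l′ l-+ l′-+ u v =
  trans (cong₂ _xor_ (l-+ u v) (l′-+ u v)) (interchange (l u) (l v) (l′ u) (l′ v))
  where open CommutativeSemigroupProperties
               (CommutativeRing.+-commutativeSemigroup Bool.xor-∧-commutativeRing)
         using (interchange)

∑³ : (𝔽₂^ k → 𝔽₂^ k → 𝔽₂^ k → ℤ) → ℤ
∑³ g = ∑ λ x → ∑ λ y → ∑ λ z → g x y z

derivativeSum : (t : 𝔽₂^ k → 𝔽₂^ k → 𝔽₂^ k → Bool) (p : 𝔽₂^ k → 𝔽₂^ k → 𝔽₂^ k → Bool) →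
                𝔽₂^ k → 𝔽₂^ k → 𝔽₂^ k → ℤ
derivativeSum t p a₁ a₂ a₃ =
  ∑³ λ x y z → ⟦ p x y z ⟧ ℤ.* χ (t (x ⊕ a₁) (y ⊕ a₂) (z ⊕ a₃) xor t x y z)

-- Over the two-element field, a non-empty set is affine exactly when it contains the sum of any
-- three of its points. This form mentions no basis and is preserved when the three blocks are
-- permuted.
record Affine (p : 𝔽₂^ k → 𝔽₂^ k → 𝔽₂^ k → Bool) : Set where
  field
    closed : ∀ {x y z x′ y′ z′ x″ y″ z″} →
             p x y z ≡ true → p x′ y′ z′ ≡ true → p x″ y″ z″ ≡ true →
             p ((x ⊕ x′) ⊕ x″) ((y ⊕ y′) ⊕ y″) ((z ⊕ z′) ⊕ z″) ≡ true

module _ {t : 𝔽₂^ k → 𝔽₂^ k → 𝔽₂^ k → Bool} (T : SymmetricTrilinear t)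
         {p : 𝔽₂^ k → 𝔽₂^ k → 𝔽₂^ k → Bool} (p-affine : Affine p)
         {o₁ o₂ o₃ : 𝔽₂^ k} (o∈p : p o₁ o₂ o₃ ≡ true) where

  open SymmetricTrilinear T
  open Affine p-affine

  module Fibre {a₁ : 𝔽₂^ k} (a₁≢𝟎 : a₁ ≢ 𝟎) (a₂ a₃ : 𝔽₂^ k) where

    open ≡-Reasoning
    open xor-∧-Solver using (solve; _:+_; _:=_)

    D : 𝔽₂^ k → 𝔽₂^ k → 𝔽₂^ k → Bool
    D x y z = t (x ⊕ a₁) (y ⊕ a₂) (z ⊕ a₃) xor t x y z

    -- The indicator of W, read off in the fibre through the base point `o₁ o₂ o₃`.
    direction : 𝔽₂^ k → Bool
    direction w = p o₁ o₂ (o₃ ⊕ w)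

    -- Adding the two points (x, y, z) and (o₁, o₂, o₃) carries (x, y, w + z) to (o₁, o₂, o₃ + w)
    -- and back, so three-point closure gives both directions. Hence all non-empty fibres are
    -- translates of the same W.
    direction-translate : ∀ {x y z} → p x y z ≡ true → ∀ w → p x y (w ⊕ z) ≡ direction w
    direction-translate {x} {y} {z} pz w = ≡true-ext
      (λ pwz → trans (sym (cong₃ (⊕-cancelˡ x o₁) (⊕-cancelˡ y o₂)
                  (trans (cong (_⊕ o₃) (⊕-cancelʳ w z)) (⊕-comm w o₃)))) (closed pwz pz o∈p))
      (λ dw → trans (sym (cong₃ (⊕-cancelˡ o₁ x) (⊕-cancelˡ o₂ y)
                  (cong (_⊕ z) (trans (cong (_⊕ o₃) (⊕-comm o₃ w)) (⊕-cancelʳ w o₃)))))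
                  (closed dw o∈p pz))
      where
      cong₃ : ∀ {x x′ y y′ z z′} → x ≡ x′ → y ≡ y′ → z ≡ z′ → p x y z ≡ p x′ y′ z′
      cong₃ refl refl refl = refl

    direction-+ : ∀ u → direction u ≡ true → ∀ w → direction (w ⊕ u) ≡ direction w
    direction-+ u du w = trans (cong (p o₁ o₂) (⊕.x∙yz≈y∙xz o₃ w u)) (direction-translate du w)

    direction-𝟎 : direction 𝟎 ≡ true
    direction-𝟎 = trans (cong (p o₁ o₂) (⊕-identityʳ o₃)) o∈p

    slope : 𝔽₂^ k → 𝔽₂^ k → 𝔽₂^ k → Bool
    slope x y w = t a₁ y w xor t (x ⊕ a₁) a₂ w

    slope-additive : ∀ x y → Additive (slope x y)
    slope-additive x y = Additive-xor (t a₁ y) (t (x ⊕ a₁) a₂)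
      (additive₃ a₁ y) (additive₃ (x ⊕ a₁) a₂)

    D-translate : ∀ x y z w → D x y (w ⊕ z) ≡ slope x y w xor D x y z
    D-translate x y z w = begin
      t (x ⊕ a₁) (y ⊕ a₂) ((w ⊕ z) ⊕ a₃) xor t x y (w ⊕ z)
        ≡⟨ cong₂ _xor_ (trans (cong (t (x ⊕ a₁) (y ⊕ a₂)) (⊕-assoc w z a₃))
                              (additive₃ _ _ w (z ⊕ a₃)))
                       (additive₃ x y w z) ⟩
      (t (x ⊕ a₁) (y ⊕ a₂) w xor t (x ⊕ a₁) (y ⊕ a₂) (z ⊕ a₃)) xor (t x y w xor t x y z)
        -- Expanding `y ⊕ a₂` before `x ⊕ a₁` keeps `t (x ⊕ a₁) a₂ w` whole. Then `y` meets `w` only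
        -- in `t a₁ y w` and in `t x y w`, and the latter cancels against the undifferentiated term.
        ≡⟨ cong (λ b → (b xor _) xor _)
             (trans (additive₂ (x ⊕ a₁) y a₂ w) (cong (_xor _) (additive₁ x a₁ y w))) ⟩
      (((t x y w xor t a₁ y w) xor t (x ⊕ a₁) a₂ w) xor t (x ⊕ a₁) (y ⊕ a₂) (z ⊕ a₃))
        xor (t x y w xor t x y z)
        ≡⟨ rearrange (t x y w) (t a₁ y w) (t (x ⊕ a₁) a₂ w) _ (t x y z) ⟩
      slope x y w xor D x y z ∎
      where
      rearrange : ∀ b c d e f → (((b xor c) xor d) xor e) xor (b xor f) ≡ (c xor d) xor (e xor f)
      rearrange = solve 5 (λ b c d e f → (((b :+ c) :+ d) :+ e) :+ (b :+ f)
                                       := (c :+ d) :+ (e :+ f)) refl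

    characterSum : 𝔽₂^ k → 𝔽₂^ k → ℤ
    characterSum x y = ∑ λ w → ⟦ direction w ⟧ ℤ.* χ (slope x y w)

    characterSum≥0 : ∀ x y → 0ℤ ℤ.≤ characterSum x y
    characterSum≥0 x y = twisted-sum≥0 direction (slope x y) (slope-additive x y) direction-+

    fibreSum : 𝔽₂^ k → 𝔽₂^ k → ℤ
    fibreSum x y = ∑ λ z → ⟦ p x y z ⟧ ℤ.* χ (D x y z)

    -- Any point of the fibre can serve as its origin; the choice affects only the sign in front.
    fibreSum≡ : ∀ {x y z} → p x y z ≡ true → fibreSum x y ≡ characterSum x y ℤ.* χ (D x y z)
    fibreSum≡ {x} {y} {z} pz = begin
      fibreSum x y
        ≡⟨ ∑-shift z _ ⟨
      (∑ λ w → ⟦ p x y (w ⊕ z) ⟧ ℤ.* χ (D x y (w ⊕ z)))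
        ≡⟨ ∑-cong (λ w → cong₂ (λ b b′ → ⟦ b ⟧ ℤ.* χ b′)
                            (direction-translate pz w) (D-translate x y z w)) ⟩
      (∑ λ w → ⟦ direction w ⟧ ℤ.* χ (slope x y w xor D x y z))
        ≡⟨ ∑-cong (λ w → trans (cong (⟦ direction w ⟧ ℤ.*_) (χ-xor (slope x y w) (D x y z)))
                               (sym (ℤ.*-assoc ⟦ direction w ⟧ _ _))) ⟩
      (∑ λ w → (⟦ direction w ⟧ ℤ.* χ (slope x y w)) ℤ.* χ (D x y z))
        ≡⟨ ∑-*ʳ (λ w → ⟦ direction w ⟧ ℤ.* χ (slope x y w)) (χ (D x y z)) ⟩
      characterSum x y ℤ.* χ (D x y z) ∎

    -- An equality for a non-empty fibre; for an empty one it is non-negativity. Keeping the bound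
    -- in the second case matters, because it is the sum over all `y` that collapses.
    ∣fibreSum∣≤ : ∀ x y → + ∣ fibreSum x y ∣ ℤ.≤ characterSum x y
    ∣fibreSum∣≤ x y with search (p x y)
    ... | inj₁ (z , pz) = ℤ.≤-reflexive (begin
      + ∣ fibreSum x y ∣                           ≡⟨ cong (+_ ∘ ∣_∣) (fibreSum≡ pz) ⟩
      + ∣ characterSum x y ℤ.* χ (D x y z) ∣       ≡⟨ cong +_ (ℤ.abs-* (characterSum x y) _) ⟩
      + (∣ characterSum x y ∣ * ∣ χ (D x y z) ∣)   ≡⟨ cong (λ i → + (∣ characterSum x y ∣ * i))
                                                          (∣χ∣≡1 (D x y z)) ⟩
      + (∣ characterSum x y ∣ * 1)                 ≡⟨ cong +_ (ℕ.*-identityʳ _) ⟩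
      + ∣ characterSum x y ∣                       ≡⟨ ℤ.0≤i⇒+∣i∣≡i (characterSum≥0 x y) ⟩
      characterSum x y                             ∎)
    ... | inj₂ empty = subst (λ i → + ∣ i ∣ ℤ.≤ characterSum x y)
      (sym (∑-zero _ (λ z → cong (λ b → ⟦ b ⟧ ℤ.* χ (D x y z)) (empty z)))) (characterSum≥0 x y)

    ∑χ[t] : ∀ w → w ≢ 𝟎 → ∑ (λ y → χ (t a₁ y w)) ≡ 0ℤ
    ∑χ[t] w w≢𝟎 with nondegenerate a₁≢𝟎 w≢𝟎
    ... | u , tu = trans (∑-cong (λ y → sym (ℤ.*-identityˡ (χ (t a₁ y w)))))
      (twisted-sum≡0 (λ _ → true) (λ y → t a₁ y w) (λ y y′ → additive₂ a₁ y y′ w) u (λ _ → refl) tu)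

    ∑-characterSum : ∀ x → ∑ (characterSum x) ≡ + (2 ^ k)
    ∑-characterSum x = begin
      (∑ λ y → ∑ λ w → ⟦ direction w ⟧ ℤ.* χ (slope x y w))
        ≡⟨ ∑-comm (λ y w → ⟦ direction w ⟧ ℤ.* χ (slope x y w)) ⟩
      (∑ λ w → ∑ λ y → ⟦ direction w ⟧ ℤ.* χ (slope x y w))
        -- Neither W nor the second summand of `slope` involves `y`, so both leave the inner sum as
        -- `weight w`.
        ≡⟨ ∑-cong (λ w → trans (∑-cong (factor w)) (∑-*ʳ (λ y → χ (t a₁ y w)) (weight w))) ⟩
      (∑ λ w → ∑ (λ y → χ (t a₁ y w)) ℤ.* weight w)
        ≡⟨ ∑-support _ 𝟎 (λ w w≢𝟎 → cong (ℤ._* weight w) (∑χ[t] w w≢𝟎)) ⟩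
      ∑ (λ y → χ (t a₁ y 𝟎)) ℤ.* weight 𝟎
        ≡⟨ cong₂ ℤ._*_ (∑-cong (λ y → cong χ (Additive⇒𝟎 (t a₁ y) (additive₃ a₁ y)))) weight-𝟎 ⟩
      ∑ {k} (λ _ → 1ℤ) ℤ.* 1ℤ
        ≡⟨ ℤ.*-identityʳ _ ⟩
      ∑ {k} (λ _ → 1ℤ)
        ≡⟨ ∑-const k 1 ⟩
      + (2 ^ k * 1)
        ≡⟨ cong +_ (ℕ.*-identityʳ (2 ^ k)) ⟩
      + (2 ^ k) ∎
      where
      weight : 𝔽₂^ k → ℤ
      weight w = χ (t (x ⊕ a₁) a₂ w) ℤ.* ⟦ direction w ⟧
      weight-𝟎 : weight 𝟎 ≡ 1ℤ
      weight-𝟎 = cong₂ (λ b b′ → χ b ℤ.* ⟦ b′ ⟧)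
                       (Additive⇒𝟎 (t (x ⊕ a₁) a₂) (additive₃ (x ⊕ a₁) a₂)) direction-𝟎
      factor : ∀ w y → ⟦ direction w ⟧ ℤ.* χ (slope x y w) ≡ χ (t a₁ y w) ℤ.* weight w
      factor w y = begin
        ⟦ direction w ⟧ ℤ.* χ (slope x y w)
          ≡⟨ ℤ.*-comm ⟦ direction w ⟧ _ ⟩
        χ (slope x y w) ℤ.* ⟦ direction w ⟧
          ≡⟨ cong (ℤ._* ⟦ direction w ⟧) (χ-xor (t a₁ y w) _) ⟩
        (χ (t a₁ y w) ℤ.* χ (t (x ⊕ a₁) a₂ w)) ℤ.* ⟦ direction w ⟧
          ≡⟨ ℤ.*-assoc (χ (t a₁ y w)) _ _ ⟩
        χ (t a₁ y w) ℤ.* weight w ∎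

    ∣derivativeSum∣≤ : ∣ derivativeSum t p a₁ a₂ a₃ ∣ ≤ 2 ^ k * 2 ^ k
    ∣derivativeSum∣≤ = ℤ.drop‿+≤+ (ℤ.≤-trans
      (∣∑∣≤ (λ x → ∣∑∣≤ (∣fibreSum∣≤ x)))
      (ℤ.≤-reflexive (trans (∑-cong ∑-characterSum) (∑-const k (2 ^ k)))))

module _ {t : 𝔽₂^ k → 𝔽₂^ k → 𝔽₂^ k → Bool} (T : SymmetricTrilinear t)
         {p : 𝔽₂^ k → 𝔽₂^ k → 𝔽₂^ k → Bool} (p-affine : Affine p)
         {o₁ o₂ o₃ : 𝔽₂^ k} (o∈p : p o₁ o₂ o₃ ≡ true) where

  open SymmetricTrilinear T
  open Affine p-affine

  ∣derivativeSum∣≤ : ∀ a₁ a₂ a₃ → ¬ (a₁ ≡ 𝟎 × a₂ ≡ 𝟎 × a₃ ≡ 𝟎) →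
                     ∣ derivativeSum t p a₁ a₂ a₃ ∣ ≤ 2 ^ k * 2 ^ k
  ∣derivativeSum∣≤ a₁ a₂ a₃ a≢𝟎 with a₁ ≟ 𝟎 | a₂ ≟ 𝟎 | a₃ ≟ 𝟎
    where
    _≟_ = Vec.≡-dec Bool._≟_
  ... | no a₁≢𝟎 | _ | _ = Fibre.∣derivativeSum∣≤ T p-affine o∈p a₁≢𝟎 a₂ a₃
  ... | yes _ | no a₂≢𝟎 | _ = subst (λ i → ∣ i ∣ ≤ 2 ^ k * 2 ^ k) (begin
    derivativeSum t p′ a₂ a₁ a₃
      ≡⟨ ∑-comm (λ y x → ∑ λ z → ⟦ p x y z ⟧ ℤ.* χ (t (y ⊕ a₂) (x ⊕ a₁) (z ⊕ a₃) xor t y x z)) ⟩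
    (∑³ λ x y z → ⟦ p x y z ⟧ ℤ.* χ (t (y ⊕ a₂) (x ⊕ a₁) (z ⊕ a₃) xor t y x z))
      ≡⟨ (∑-cong λ x → ∑-cong λ y → ∑-cong λ z → cong (λ b → ⟦ p x y z ⟧ ℤ.* χ b)
            (cong₂ _xor_ (swap₁₂ _ _ _) (swap₁₂ _ _ _))) ⟩
    derivativeSum t p a₁ a₂ a₃ ∎)
    (Fibre.∣derivativeSum∣≤ T {p′} p′-affine o∈p a₂≢𝟎 a₁ a₃)
    where
    open ≡-Reasoning
    p′ : 𝔽₂^ k → 𝔽₂^ k → 𝔽₂^ k → Bool
    p′ y x z = p x y z
    p′-affine : Affine p′
    p′-affine = record { closed = closed }
  ... | yes _ | yes _ | no a₃≢𝟎 = subst (λ i → ∣ i ∣ ≤ 2 ^ k * 2 ^ k) (begin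
    derivativeSum t p′ a₃ a₂ a₁
      -- Reversing the order of summation takes three exchanges of neighbouring variables.
      ≡⟨ ∑-cong (λ z → ∑-comm (λ y x → g x y z)) ⟩
    (∑³ λ z x y → g x y z)
      ≡⟨ ∑-comm (λ z x → ∑ λ y → g x y z) ⟩
    (∑³ λ x z y → g x y z)
      ≡⟨ ∑-cong (λ x → ∑-comm (λ z y → g x y z)) ⟩
    ∑³ g
      ≡⟨ (∑-cong λ x → ∑-cong λ y → ∑-cong λ z → cong (λ b → ⟦ p x y z ⟧ ℤ.* χ b)
            (cong₂ _xor_ (swap₁₃ _ _ _) (swap₁₃ _ _ _))) ⟩
    derivativeSum t p a₁ a₂ a₃ ∎)
    (Fibre.∣derivativeSum∣≤ T {p′} p′-affine o∈p a₃≢𝟎 a₂ a₁)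
    where
    open ≡-Reasoning
    p′ : 𝔽₂^ k → 𝔽₂^ k → 𝔽₂^ k → Bool
    p′ z y x = p x y z
    p′-affine : Affine p′
    p′-affine = record { closed = closed }
    g : 𝔽₂^ k → 𝔽₂^ k → 𝔽₂^ k → ℤ
    g x y z = ⟦ p x y z ⟧ ℤ.* χ (t (z ⊕ a₃) (y ⊕ a₂) (x ⊕ a₁) xor t z y x)
  ... | yes a₁≡𝟎 | yes a₂≡𝟎 | yes a₃≡𝟎 = contradiction (a₁≡𝟎 , a₂≡𝟎 , a₃≡𝟎) a≢𝟎

-- Affine subspaces: summation, decidability, size

does-true : ∀ {a} {A : Set a} (a? : Dec A) → does a? ≡ true → A
does-true (yes a) _ = a

•-xor : ∀ b b′ (v : 𝔽₂^ n) → (b xor b′) • v ≡ b • v ⊕ b′ • v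
•-xor b b′ []      = refl
•-xor b b′ (c ∷ v) = cong₂ _∷_ (Bool.∧-distribʳ-xor c b b′) (•-xor b b′ v)

linearCombination-⊕ : (cs cs′ : 𝔽₂^ d) (vs : Vec (𝔽₂^ n) d) →
  linearCombination (cs ⊕ cs′) vs ≡ linearCombination cs vs ⊕ linearCombination cs′ vs
linearCombination-⊕ []       []         []       = sym (⊕-identityˡ 𝟎)
linearCombination-⊕ (c ∷ cs) (c′ ∷ cs′) (v ∷ vs) =
  trans (cong₂ _⊕_ (•-xor c c′ v) (linearCombination-⊕ cs cs′ vs))
        (⊕.interchange (c • v) (c′ • v) (linearCombination cs vs) (linearCombination cs′ vs))

linearCombination-injective : {vs : Vec (𝔽₂^ n) d} → LinearlyIndependent vs → ∀ cs cs′ →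
  linearCombination cs vs ≡ linearCombination cs′ vs → cs ≡ cs′
linearCombination-injective {vs = vs} indep cs cs′ e = ⊕≡𝟎⇒≡ cs cs′ (indep (cs ⊕ cs′) (begin
  linearCombination (cs ⊕ cs′) vs                         ≡⟨ linearCombination-⊕ cs cs′ vs ⟩
  linearCombination cs vs ⊕ linearCombination cs′ vs      ≡⟨ cong (_⊕ linearCombination cs′ vs) e ⟩
  linearCombination cs′ vs ⊕ linearCombination cs′ vs     ≡⟨ ⊕-self _ ⟩
  𝟎                                                       ∎))
  where open ≡-Reasoning

module _ {S : Pred (𝔽₂^ n) 0ℓ} (S? : Decidable S) where

  indicator : 𝔽₂^ n → ℤ
  indicator v = ⟦ does (S? v) ⟧

  private
    sumList : List ℤ → ℤ
    sumList = List.foldr ℤ._+_ 0ℤ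

    sumList-filter : (g : 𝔽₂^ n → ℤ) (vs : List (𝔽₂^ n)) →
      sumList (List.map g (List.filter S? vs)) ≡ sumList (List.map (λ v → indicator v ℤ.* g v) vs)
    sumList-filter g []       = refl
    sumList-filter g (v ∷ vs) with does (S? v)
    ... | true  = cong₂ ℤ._+_ (sym (ℤ.*-identityˡ (g v))) (sumList-filter g vs)
    ... | false = trans (sumList-filter g vs) (sym (ℤ.+-identityˡ _))

    sumList-++ : ∀ is js → sumList (is List.++ js) ≡ sumList is ℤ.+ sumList js
    sumList-++ []       js = sym (ℤ.+-identityˡ _)
    sumList-++ (i ∷ is) js = trans (cong (ℤ._+_ i) (sumList-++ is js)) (sym (ℤ.+-assoc i _ _))

    sumList-allVectors : ∀ m (g : 𝔽₂^ m → ℤ) → sumList (List.map g (allVectors m)) ≡ ∑ g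
    sumList-allVectors zero    g = ℤ.+-identityʳ (g [])
    sumList-allVectors (suc m) g = begin
      sumList (List.map g (List.map (false ∷_) vs List.++ List.map (true ∷_) vs List.++ []))
        ≡⟨ cong (λ us → sumList (List.map g (List.map (false ∷_) vs List.++ us)))
                (List.++-identityʳ _) ⟩
      sumList (List.map g (List.map (false ∷_) vs List.++ List.map (true ∷_) vs))
        ≡⟨ cong sumList (List.map-++ g (List.map (false ∷_) vs) _) ⟩
      sumList (List.map g (List.map (false ∷_) vs) List.++ List.map g (List.map (true ∷_) vs))
        ≡⟨ sumList-++ (List.map g (List.map (false ∷_) vs)) _ ⟩
      sumList (List.map g (List.map (false ∷_) vs)) ℤ.+ sumList (List.map g (List.map (true ∷_) vs))
        ≡⟨ cong₂ ℤ._+_ (half false) (half true) ⟩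
      ∑ g ∎
      where
      open ≡-Reasoning
      vs = allVectors m
      half : ∀ b → sumList (List.map g (List.map (b ∷_) vs)) ≡ ∑ (g ∘ (b ∷_))
      half b = trans (cong sumList (sym (List.map-∘ vs))) (sumList-allVectors m (g ∘ (b ∷_)))

    sumList-1 : (vs : List (𝔽₂^ n)) → sumList (List.map (λ _ → 1ℤ) vs) ≡ + List.length vs
    sumList-1 []       = refl
    sumList-1 (v ∷ vs) = cong (ℤ._+_ 1ℤ) (sumList-1 vs)

  sum-elements : (g : 𝔽₂^ n → ℤ) →
    List.foldr ℤ._+_ 0ℤ (List.map g (elements S?)) ≡ ∑ (λ v → indicator v ℤ.* g v)
  sum-elements g = trans (sumList-filter g (allVectors n)) (sumList-allVectors n _)

  ∑-indicator : ∑ indicator ≡ + size S?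
  ∑-indicator = begin
    ∑ indicator                                ≡⟨ ∑-cong (λ v → sym (ℤ.*-identityʳ (indicator v))) ⟩
    ∑ (λ v → indicator v ℤ.* 1ℤ)               ≡⟨ sum-elements (λ _ → 1ℤ) ⟨
    sumList (List.map (λ _ → 1ℤ) (elements S?)) ≡⟨ sumList-1 (elements S?) ⟩
    + size S?                                  ∎
    where open ≡-Reasoning

  ∑-indicator-cong : {g h : 𝔽₂^ n → ℤ} → (∀ v → S v → g v ≡ h v) →
                     ∑ (λ v → indicator v ℤ.* g v) ≡ ∑ (λ v → indicator v ℤ.* h v)
  ∑-indicator-cong {g} {h} g≡h = ∑-cong pointwise
    where
    pointwise : ∀ v → indicator v ℤ.* g v ≡ indicator v ℤ.* h v
    pointwise v with S? v
    ... | yes v∈S = cong (1ℤ ℤ.*_) (g≡h v v∈S)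
    ... | no  _   = refl

_≟ⱽ_ : (u v : 𝔽₂^ n) → Dec (u ≡ v)
_≟ⱽ_ = Vec.≡-dec Bool._≟_

module _ {S : Pred (𝔽₂^ n) 0ℓ} (aff : IsAffineSubspace d S) where
  open IsAffineSubspace aff
  open ≡-Reasoning

  private
    L : 𝔽₂^ d → 𝔽₂^ n
    L cs = linearCombination cs basis

  -- Of the three copies of `origin`, two cancel and one remains.
  affine-closed : ∀ {x y z} → S x → S y → S z → S ((x ⊕ y) ⊕ z)
  affine-closed x∈S y∈S z∈S
    with cs , refl ← Equivalence.to (membership _) x∈S
       | cs′ , refl ← Equivalence.to (membership _) y∈S
       | cs″ , refl ← Equivalence.to (membership _) z∈S
    = Equivalence.from (membership _) ((cs ⊕ cs′) ⊕ cs″ , (begin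
      ((origin ⊕ L cs) ⊕ (origin ⊕ L cs′)) ⊕ (origin ⊕ L cs″)
        ≡⟨ cong (_⊕ (origin ⊕ L cs″)) (⊕.interchange origin (L cs) origin (L cs′)) ⟩
      ((origin ⊕ origin) ⊕ (L cs ⊕ L cs′)) ⊕ (origin ⊕ L cs″)
        ≡⟨ cong (_⊕ (origin ⊕ L cs″)) (⊕-cancelˡ origin _) ⟩
      (L cs ⊕ L cs′) ⊕ (origin ⊕ L cs″)
        ≡⟨ ⊕.x∙yz≈y∙xz (L cs ⊕ L cs′) origin (L cs″) ⟩
      origin ⊕ ((L cs ⊕ L cs′) ⊕ L cs″)
        ≡⟨ cong (λ v → origin ⊕ (v ⊕ L cs″)) (linearCombination-⊕ cs cs′ basis) ⟨
      origin ⊕ (L (cs ⊕ cs′) ⊕ L cs″)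
        ≡⟨ cong (origin ⊕_) (linearCombination-⊕ (cs ⊕ cs′) cs″ basis) ⟨
      origin ⊕ L ((cs ⊕ cs′) ⊕ cs″) ∎))

  coordinates? : ∀ x → Dec (∃ λ cs → x ≡ origin ⊕ L cs)
  coordinates? x with search (λ cs → does (x ≟ⱽ (origin ⊕ L cs)))
  ... | inj₁ (cs , e) = yes (cs , does-true (x ≟ⱽ _) e)
  ... | inj₂ none     = no λ (cs , e) →
    contradiction (trans (sym (none cs)) (dec-true (x ≟ⱽ _) e)) λ ()

  -- The disperser property speaks of an arbitrary predicate; searching the finitely many
  -- coefficient vectors makes it possible to sum over it.
  affine-decidable : Decidable S
  affine-decidable x =
    map′ (Equivalence.from (membership x)) (Equivalence.to (membership x)) (coordinates? x)

  affine-injective : ∀ cs cs′ → origin ⊕ L cs ≡ origin ⊕ L cs′ → cs ≡ cs′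
  affine-injective cs cs′ e = linearCombination-injective independent cs cs′ (begin
    L cs                            ≡⟨ ⊕-cancelʳ (L cs) origin ⟨
    (L cs ⊕ origin) ⊕ origin        ≡⟨ cong (_⊕ origin) (⊕-comm (L cs) origin) ⟩
    (origin ⊕ L cs) ⊕ origin        ≡⟨ cong (_⊕ origin) e ⟩
    (origin ⊕ L cs′) ⊕ origin       ≡⟨ cong (_⊕ origin) (⊕-comm origin (L cs′)) ⟩
    (L cs′ ⊕ origin) ⊕ origin       ≡⟨ ⊕-cancelʳ (L cs′) origin ⟩
    L cs′                           ∎)

  module _ (S? : Decidable S) where

    private
      δ : 𝔽₂^ n → 𝔽₂^ d → ℤ
      δ x cs = ⟦ does (x ≟ⱽ (origin ⊕ L cs)) ⟧

      δ≡1 : ∀ cs → δ (origin ⊕ L cs) cs ≡ 1ℤ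
      δ≡1 cs = cong ⟦_⟧ (dec-true ((origin ⊕ L cs) ≟ⱽ (origin ⊕ L cs)) refl)

      δ≡0 : ∀ x cs → x ≢ origin ⊕ L cs → δ x cs ≡ 0ℤ
      δ≡0 x cs x≢ = cong ⟦_⟧ (dec-false (x ≟ⱽ (origin ⊕ L cs)) x≢)

      indicator≥0 : ∀ x → 0ℤ ℤ.≤ indicator S? x
      indicator≥0 x with does (S? x)
      ... | true  = ℤ.+≤+ z≤n
      ... | false = ℤ.+≤+ z≤n

      ∑δ≤indicator : ∀ x → ∑ (δ x) ℤ.≤ indicator S? x
      ∑δ≤indicator x with coordinates? x
      ... | yes (cs , refl) = ℤ.≤-reflexive (begin
        ∑ (δ x)         ≡⟨ ∑-support (δ x) cs (λ cs′ cs′≢cs →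
                             δ≡0 x cs′ (cs′≢cs ∘ sym ∘ affine-injective cs cs′)) ⟩
        δ x cs          ≡⟨ δ≡1 cs ⟩
        1ℤ              ≡⟨ cong ⟦_⟧ (dec-true (S? x)
                             (Equivalence.from (membership x) (cs , refl))) ⟨
        indicator S? x  ∎)
      ... | no none = subst (ℤ._≤ indicator S? x)
        (sym (∑-zero (δ x) (λ cs → δ≡0 x cs (λ e → none (cs , e))))) (indicator≥0 x)

    -- Double counting of the pairs `x`, `cs` with `x ≡ origin ⊕ L cs`: each `cs` belongs to one
    -- `x`, while by independence each `x` belongs to at most one `cs`, and to none unless it lies
    -- in `S`. A lower bound suffices, as the size stands in the denominator of the bias.
    2^d≤size : 2 ^ d ≤ size S?
    2^d≤size = ℤ.drop‿+≤+ (subst₂ ℤ._≤_ (begin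
      ∑ (λ x → ∑ (δ x))           ≡⟨ ∑-comm δ ⟩
      ∑ (λ cs → ∑ (λ x → δ x cs)) ≡⟨ ∑-cong (λ cs → trans
                                       (∑-support _ (origin ⊕ L cs) (λ x → δ≡0 x cs)) (δ≡1 cs)) ⟩
      ∑ {d} (λ _ → 1ℤ)            ≡⟨ ∑-const d 1 ⟩
      + (2 ^ d * 1)               ≡⟨ cong +_ (ℕ.*-identityʳ (2 ^ d)) ⟩
      + (2 ^ d)                   ∎)
      (∑-indicator S?) (∑-mono-≤ ∑δ≤indicator))

-- A rational is stored in lowest terms, so the cross-multiplication is done on unnormalised
-- fractions.
∣i/n∣≤1/m : ∀ i m n .{{_ : NonZero m}} .{{_ : NonZero n}} → ∣ i ∣ * m ≤ n →
            ℚ.∣ i ℚ./ n ∣ ℚ.≤ (+ 1) ℚ./ m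
∣i/n∣≤1/m i m@(suc m-1) n@(suc n-1) ∣i∣m≤n = ℚ.toℚᵘ-cancel-≤ (begin
  ℚ.toℚᵘ ℚ.∣ i ℚ./ n ∣           ≃⟨ ℚ.toℚᵘ-homo-∣-∣ (i ℚ./ n) ⟩
  ℚᵘ.∣ ℚ.toℚᵘ (i ℚ./ n) ∣        ≃⟨ ℚᵘ.∣-∣-cong (ℚ.toℚᵘ-fromℚᵘ (ℚᵘ.mkℚᵘ i n-1)) ⟩
  ℚᵘ.mkℚᵘ (+ ∣ i ∣) n-1          ≤⟨ ℚᵘ.*≤* (subst₂ ℤ._≤_ (ℤ.pos-* ∣ i ∣ m)
                                       (sym (ℤ.*-identityˡ (+ n))) (ℤ.+≤+ ∣i∣m≤n)) ⟩
  ℚᵘ.mkℚᵘ (+ 1) m-1              ≃⟨ ℚ.toℚᵘ-fromℚᵘ (ℚᵘ.mkℚᵘ (+ 1) m-1) ⟨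
  ℚ.toℚᵘ ((+ 1) ℚ./ m)           ∎)
  where open ℚᵘ.≤-Reasoning

-- Triples as vectors of length 3k

2^k*2^k : ∀ k → 2 ^ k * 2 ^ k ≡ 2 ^ (2 * k)
2^k*2^k k = trans (sym (ℕ.^-distribˡ-+-* 2 k k)) (cong (λ j → 2 ^ (k + j)) (sym (ℕ.+-identityʳ k)))

-- The final `[]` is there because `3 * k` unfolds to `k + (k + (k + 0))`.
triple : 𝔽₂^ k → 𝔽₂^ k → 𝔽₂^ k → 𝔽₂^ (3 * k)
triple x y z = x ++ (y ++ (z ++ []))

∑-triple : (g : 𝔽₂^ (3 * k) → ℤ) → ∑ g ≡ ∑³ (λ x y z → g (triple {k} x y z))
∑-triple {k} g = trans (∑-++ {k + (k + 0)} k g) (∑-cong {k} λ x →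
  trans (∑-++ {k + 0} k (λ v → g (x ++ v)))
  (∑-cong {k} λ y → ∑-++ {0} k (λ v → g (x ++ (y ++ v)))))

triple-⊕ : (x y z x′ y′ z′ : 𝔽₂^ k) →
           triple x y z ⊕ triple x′ y′ z′ ≡ triple (x ⊕ x′) (y ⊕ y′) (z ⊕ z′)
triple-⊕ x y z x′ y′ z′ = trans (Vec.zipWith-++ _xor_ x _ x′ _) (cong ((x ⊕ x′) ++_)
  (trans (Vec.zipWith-++ _xor_ y _ y′ _) (cong ((y ⊕ y′) ++_) (Vec.zipWith-++ _xor_ z _ z′ _))))

triple-𝟎 : triple {k} 𝟎 𝟎 𝟎 ≡ 𝟎
triple-𝟎 {k} = trans (cong (λ v → 𝟎 {k} ++ (𝟎 {k} ++ v)) (𝟎-++ k))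
  (trans (cong (𝟎 {k} ++_) (𝟎-++ k)) (𝟎-++ k))
  where
  𝟎-++ : ∀ m {n} → 𝟎 {m} ++ 𝟎 {n} ≡ 𝟎
  𝟎-++ zero    = refl
  𝟎-++ (suc m) = cong (false ∷_) (𝟎-++ m)

data Triple (k : ℕ) : 𝔽₂^ (3 * k) → Set where
  mkTriple : (x y z : 𝔽₂^ k) → Triple k (triple x y z)

asTriple : (v : 𝔽₂^ (3 * k)) → Triple k v
asTriple {k} v with Vec.splitAt k v
... | x , v , refl with Vec.splitAt k v
... | y , v , refl with Vec.splitAt k v
... | z , [] , refl = mkTriple x y z

take-++ : (u : 𝔽₂^ m) (v : 𝔽₂^ n) → Vec.take m (u ++ v) ≡ u
take-++ {m} u v = Vec.++-injectiveˡ (Vec.take m (u ++ v)) u (Vec.take++drop≡id m (u ++ v))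

drop-++ : (u : 𝔽₂^ m) (v : 𝔽₂^ n) → Vec.drop m (u ++ v) ≡ v
drop-++ {m} u v = Vec.++-injectiveʳ (Vec.take m (u ++ v)) u (Vec.take++drop≡id m (u ++ v))

onTriples-triple : (t : 𝔽₂^ k → 𝔽₂^ k → 𝔽₂^ k → Bool) →
  ∀ x y z → onTriples t (triple x y z) ≡ t x y z
onTriples-triple {k} t x y z
  rewrite take-++ x (y ++ (z ++ [])) | drop-++ x (y ++ (z ++ []))
        | take-++ y (z ++ []) | drop-++ y (z ++ [])
        | take-++ z [] = refl

derivative-triple : (t : 𝔽₂^ k → 𝔽₂^ k → 𝔽₂^ k → Bool) → ∀ a₁ a₂ a₃ x y z →
  derivative (triple a₁ a₂ a₃) (onTriples t) (triple x y z)
    ≡ t (x ⊕ a₁) (y ⊕ a₂) (z ⊕ a₃) xor t x y z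
derivative-triple t a₁ a₂ a₃ x y z = cong₂ _xor_
  (trans (cong (onTriples t) (triple-⊕ x y z a₁ a₂ a₃)) (onTriples-triple t _ _ _))
  (onTriples-triple t x y z)

-- The extractor and disperser properties

module _ {t : 𝔽₂^ k → 𝔽₂^ k → 𝔽₂^ k → Bool} (T : SymmetricTrilinear t) where

  private
    f : 𝔽₂^ (3 * k) → Bool
    f = onTriples t

  -- The bound does not depend on the dimension of `S`, so it serves the fixed dimension of the
  -- extractor as well as all dimensions of the disperser.
  ∣∑χ[derivative]∣≤ : ∀ a → a ≢ 𝟎 → {S : Pred (𝔽₂^ (3 * k)) 0ℓ} (S? : Decidable S) →
    IsAffineSubspace d S → ∣ ∑ (λ v → indicator S? v ℤ.* χ (derivative a f v)) ∣ ≤ 2 ^ k * 2 ^ k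
  ∣∑χ[derivative]∣≤ a a≢𝟎 {S} S? aff = bound (asTriple {k} a) (asTriple {k} o) a≢𝟎 o∈S
    where
    o   = proj₁ (IsAffineSubspace.nonempty aff)
    o∈S = proj₂ (IsAffineSubspace.nonempty aff)

    p : 𝔽₂^ k → 𝔽₂^ k → 𝔽₂^ k → Bool
    p x y z = does (S? (triple x y z))

    p-affine : Affine p
    p-affine .Affine.closed {x} {y} {z} {x′} {y′} {z′} {x″} {y″} {z″} e e′ e″ = dec-true (S? _)
      (subst S (trans (cong (_⊕ triple x″ y″ z″) (triple-⊕ x y z x′ y′ z′))
                      (triple-⊕ (x ⊕ x′) (y ⊕ y′) (z ⊕ z′) x″ y″ z″))
        (affine-closed aff (does-true (S? _) e) (does-true (S? _) e′) (does-true (S? _) e″)))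

    bound : ∀ {a o} → Triple k a → Triple k o → a ≢ 𝟎 → S o →
            ∣ ∑ (λ v → indicator S? v ℤ.* χ (derivative a f v)) ∣ ≤ 2 ^ k * 2 ^ k
    bound (mkTriple a₁ a₂ a₃) (mkTriple o₁ o₂ o₃) a≢𝟎 o∈S = subst (λ i → ∣ i ∣ ≤ 2 ^ k * 2 ^ k)
      (sym (trans (∑-triple {k} _) (∑-cong λ x → ∑-cong λ y → ∑-cong λ z →
        cong (λ b → ⟦ p x y z ⟧ ℤ.* χ b) (derivative-triple t a₁ a₂ a₃ x y z))))
      (∣derivativeSum∣≤ T p-affine {o₁} {o₂} {o₃} (dec-true (S? _) o∈S) a₁ a₂ a₃
        λ { (refl , refl , refl) → a≢𝟎 (triple-𝟎 {k}) })

  derivative-extractor : ∀ c → IsDirectionalAffineExtractor f (2 * k + c) (2^- c)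
  derivative-extractor c a a≢𝟎 S? aff =
    ∣i/n∣≤1/m (List.foldr ℤ._+_ 0ℤ (List.map (χ ∘ derivative a f) (elements S?))) (2 ^ c) (size S?)
      {{ℕ.m^n≢0 2 c}} {{size-nonZero S? (IsAffineSubspace.nonempty aff)}}
      (begin
        ∣ List.foldr ℤ._+_ 0ℤ (List.map (χ ∘ derivative a f) (elements S?)) ∣ * 2 ^ c
          ≡⟨ cong (λ i → ∣ i ∣ * 2 ^ c) (sum-elements S? (χ ∘ derivative a f)) ⟩
        ∣ ∑ (λ v → indicator S? v ℤ.* χ (derivative a f v)) ∣ * 2 ^ c
          ≤⟨ ℕ.*-monoˡ-≤ (2 ^ c) (∣∑χ[derivative]∣≤ a a≢𝟎 S? aff) ⟩
        (2 ^ k * 2 ^ k) * 2 ^ c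
          ≡⟨ cong (_* 2 ^ c) (2^k*2^k k) ⟩
        2 ^ (2 * k) * 2 ^ c
          ≡⟨ ℕ.^-distribˡ-+-* 2 (2 * k) c ⟨
        2 ^ (2 * k + c)
          ≤⟨ 2^d≤size aff S? ⟩
        size S? ∎)
    where open ℕ.≤-Reasoning

  -- Subspaces of every dimension e ≥ 2k + 1 are at issue, so the argument goes back to the sum: a
  -- constant derivative would give it absolute value at least 2^e, more than 2^(2k).
  derivative-disperser : IsDirectionalAffineDisperser f (2 * k + 1)
  derivative-disperser a a≢𝟎 {e} 2k+1≤e {S} aff (b , constant) = ℕ.<-irrefl refl (begin-strict
    2 ^ (2 * k)
      <⟨ ℕ.^-monoʳ-< 2 (s≤s (s≤s z≤n)) (ℕ.≤-trans (ℕ.≤-reflexive (ℕ.+-comm 1 (2 * k))) 2k+1≤e) ⟩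
    2 ^ e
      ≤⟨ 2^d≤size aff S? ⟩
    size S?
      ≡⟨ trans (cong (size S? *_) (∣χ∣≡1 b)) (ℕ.*-identityʳ (size S?)) ⟨
    size S? * ∣ χ b ∣
      ≡⟨ ℤ.abs-* (+ size S?) (χ b) ⟨
    ∣ + size S? ℤ.* χ b ∣
      ≡⟨ cong (λ i → ∣ i ℤ.* χ b ∣) (∑-indicator S?) ⟨
    ∣ ∑ (indicator S?) ℤ.* χ b ∣
      ≡⟨ cong ∣_∣ (trans (∑-indicator-cong S? (λ v v∈S → cong χ (constant v v∈S)))
                          (∑-*ʳ (indicator S?) (χ b))) ⟨
    ∣ ∑ (λ v → indicator S? v ℤ.* χ (derivative a f v)) ∣
      ≤⟨ ∣∑χ[derivative]∣≤ a a≢𝟎 S? aff ⟩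
    2 ^ k * 2 ^ k
      ≡⟨ 2^k*2^k k ⟩
    2 ^ (2 * k) ∎)
    where
    open ℕ.≤-Reasoning
    S? : Decidable S
    S? = affine-decidable aff

theorem14 : ∀ {ℓ ℓ₁ ℓ₂ : Level} (k c : ℕ) → 1 ≤ k → 1 ≤ c →
    (𝔽 : FiniteField (2 ^ k) ℓ ℓ₁ ℓ₂) →
    (φ : 𝔽₂^ k → FiniteField.Carrier 𝔽) → IsLinearIsomorphism 𝔽 φ →
    let f = onTriples (traceProduct 𝔽 φ) in
    IsDirectionalAffineExtractor f (2 * k + c) (2^- c)
    × IsDirectionalAffineDisperser f (2 * k + 1)
theorem14 k c 1≤k _ 𝔽 φ φ-iso = derivative-extractor trilinear c , derivative-disperser trilinear
  where
  open TraceProductProperties 𝔽 φ φ-iso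
  trilinear : SymmetricTrilinear (traceProduct 𝔽 φ)
  trilinear = record
    { swap₁₂        = traceProduct-swap₁₂
    ; swap₂₃        = traceProduct-swap₂₃
    ; additive₁     = traceProduct-additive
    ; nondegenerate = traceProduct-nondegenerate 1≤k
    }
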